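{- $t_2(n,n-2)=n+2$ for all $n\ge 6$, and $t_2(n,n-1)=n+1$ for all $n\ge 4$.
   Context: All graphs are finite, simple and undirected. An $r$-colouring of a graph $G$ is a function $c:E(G)\to\{1,\dots,r\}$ (not necessarily proper). A path is rainbow if all its edges have distinct colours. For a $2$-connected graph $G$, a colouring is rainbow $2$-connected if every two vertices of $G$ are connected by two internally vertex-disjoint rainbow paths, and the rainbow $2$-connection number $rc_2(G)$ is the minimum number of colours in a rainbow $2$-connected colouring of $G$. For integers $n$ and $r\ge 1$, $t_2(n,r)$ denotes the minimum number of edges in a $2$-connected graph $G$ on $n$ vertices with $rc_2(G)\le r$. -}

module Defs where

open import Data.Nat using (ℕ; zero; suc; _+_; _∸_; _≤_; _<ᵇ_)
open import Data.Bool using (Bool; true; false; _∧_; if_then_else_)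
open import Data.Fin using (Fin; toℕ)
open import Data.List using (List; []; _∷_; _++_; map; allFin)
open import Data.Nat.ListAction using (sum)
open import Data.List.Membership.Propositional using (_∈_; _∉_)
open import Data.List.Relation.Unary.Unique.Propositional using (Unique)
open import Data.Product using (Σ; _×_; ∃; ∃-syntax)
open import Relation.Binary.PropositionalEquality using (_≡_; _≢_)
open import Data.Unit using (⊤)

record Graph (n : ℕ) : Set where
  field
    adj    : Fin n → Fin n → Bool
    sym    : ∀ i j → adj i j ≡ adj j i
    irrefl : ∀ i → adj i i ≡ false
open Graph public

Adj : ∀ {n} → Graph n → Fin n → Fin n → Set
Adj G i j = adj G i j ≡ true

edgeCount : ∀ {n} → Graph n → ℕ
edgeCount {n} G =
  sum (map (λ i → sum (map (λ j →
         if adj G i j ∧ (toℕ i <ᵇ toℕ j) then 1 else 0) (allFin n))) (allFin n))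

Chain : ∀ {n} → Graph n → List (Fin n) → Set
Chain G []           = ⊤
Chain G (x ∷ [])     = ⊤
Chain G (x ∷ y ∷ vs) = Adj G x y × Chain G (y ∷ vs)

IsPath : ∀ {n} → Graph n → Fin n → List (Fin n) → Fin n → Set
IsPath G u mid v = Chain G (u ∷ mid ++ v ∷ []) × Unique (u ∷ mid ++ v ∷ [])

-- An r-colouring of G: a colour in Fin r for each edge (given as a
-- symmetric function on pairs; values on non-edges are irrelevant).
record Colouring {n} (G : Graph n) (r : ℕ) : Set where
  field
    col    : Fin n → Fin n → Fin r
    colSym : ∀ i j → col i j ≡ col j i
open Colouring public

edgeColours : ∀ {n r} {G : Graph n} → Colouring G r → List (Fin n) → List (Fin r)
edgeColours c []           = []
edgeColours c (x ∷ [])     = []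
edgeColours c (x ∷ y ∷ vs) = col c x y ∷ edgeColours c (y ∷ vs)

RainbowPath : ∀ {n r} {G : Graph n} → Colouring G r → Fin n → List (Fin n) → Fin n → Set
RainbowPath {G = G} c u mid v =
  IsPath G u mid v × Unique (edgeColours c (u ∷ mid ++ v ∷ []))

TwoConnected : ∀ {n} → Graph n → Set
TwoConnected {n} G =
  (3 ≤ n)
  × (∀ u v → u ≢ v → ∃[ mid ] IsPath G u mid v)
  × (∀ w u v → u ≢ v → u ≢ w → v ≢ w →
       ∃[ mid ] (IsPath G u mid v × w ∉ mid))

Rainbow2Connected : ∀ {n r} {G : Graph n} → Colouring G r → Set
Rainbow2Connected {n} c =
  ∀ (u v : Fin n) → u ≢ v →
    ∃[ mid₁ ] ∃[ mid₂ ]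
      ( RainbowPath c u mid₁ v × RainbowPath c u mid₂ v
      × mid₁ ≢ mid₂
      × (∀ x → x ∈ mid₁ → x ∉ mid₂))

Rc2≤ : ∀ {n} → Graph n → ℕ → Set
Rc2≤ G r = Σ (Colouring G r) Rainbow2Connected

Admissible : (n r : ℕ) → Graph n → Set
Admissible n r G = TwoConnected G × Rc2≤ G r

T2≡ : (n r m : ℕ) → Set
T2≡ n r m =
  (∃[ G ] (Admissible n r G × edgeCount G ≡ m))
  × (∀ (G : Graph n) → Admissible n r G → m ≤ edgeCount G)

{-# OPTIONS --safe #-}
module Submission where

-- Every edge of a cycle C_n has to be avoided by a rainbow path through all the others, so C_n needs n colours. A 2-connected
-- graph with at most n + 1 edges that is not a cycle is a theta graph, by the handshake lemma and because a single vertex of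
-- degree ≥ 3 would be a cut vertex. In a theta graph the required paths are forced: a path entering a chain of degree-2
-- vertices must run through it. Pairs of neighbours and pairs of vertices next to a branch vertex then show that only
-- end edges of different legs can share a colour, and for n ≥ 6 this leaves n - 1 distinct colours. For the upper bounds,
-- take a rainbow cycle and attach one or two vertices to the ends of one of its edges, reusing colours of the cycle.

open import Defs
open import Data.Bool using (Bool; true; false; _∧_; _∨_; if_then_else_; T)
import Data.Bool.Properties as Bool
open import Data.Empty using (⊥; ⊥-elim)
open import Data.Fin as Fin using (Fin; toℕ; fromℕ; inject₁; splitAt; _↑ˡ_; _↑ʳ_) renaming (_≟_ to _≟ᶠ_)
open import Data.Fin.Patterns using (0F; 1F; 2F)
open import Data.Fin.Properties using (any?; injective⇒≤; join-splitAt; splitAt-↑ˡ; splitAt-↑ʳ; toℕ<n; toℕ-fromℕ; toℕ-inject₁; toℕ-injective; toℕ-↑ˡ; toℕ-↑ʳ; ↑ʳ-injective) renaming (suc-injective to Fin-suc-injective)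
open import Data.List using (List; []; _∷_; _++_; allFin; cartesianProduct; length; lookup; map; tabulate)
open import Data.List.Membership.Propositional using (_∈_; _∉_)
open import Data.List.Membership.Propositional.Properties using (∈-++⁺ˡ; ∈-++⁺ʳ; ∈-++⁻; ∈-lookup; ∈-allFin; ∈-∃++; ∈-map⁺; ∈-tabulate⁺; ∈-tabulate⁻)
import Data.List.Membership.DecPropositional as DecMembership
open import Data.List.Properties using (++-assoc; ++-identityʳ; length-++; length-tabulate; map-++; map-tabulate; map-∘; ∷-injectiveˡ; ∷-injectiveʳ; ∷ʳ-injectiveˡ)
open import Data.List.Relation.Binary.Permutation.Propositional using (_↭_; ↭-refl; ↭-sym; ↭-trans; ↭⇒↭ₛ; prep; swap; module PermutationReasoning)
open import Data.List.Relation.Binary.Permutation.Propositional.Properties using (∈-resp-↭; ↭-length; ++⁺; ++⁺ˡ; ++⁺ʳ; ++-comm; ∷↭∷ʳ; shift; map⁺)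
import Data.List.Relation.Binary.Permutation.Setoid.Properties as Permutation
open import Data.List.Relation.Unary.All as All using ([]; _∷_)
import Data.List.Relation.Unary.All.Properties as All
open import Data.List.Relation.Unary.AllPairs using ([]; _∷_) renaming (tail to unique-tail)
open import Data.List.Relation.Unary.Any as Any using (here; there)
open import Data.List.Relation.Unary.Any.Properties using (lookup-index)
open import Data.List.Relation.Unary.Unique.Propositional using (Unique)
open import Data.List.Relation.Unary.Unique.Propositional.Properties as Unique using () renaming (Unique[x∷xs]⇒x∉xs to unique-head∉)
open import Data.Nat using (ℕ; zero; suc; _+_; _*_; _∸_; _≤_; _<_; z≤n; s≤s; _<ᵇ_; _≡ᵇ_; _≤?_)
open import Data.Nat.ListAction using (sum)
open import Data.Nat.ListAction.Properties using (sum-↭; sum-++)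
open import Data.Nat.Properties using (*-identityʳ; *-zeroʳ; +-assoc; +-cancelˡ-<; +-comm; +-mono-≤; +-monoʳ-<; +-monoʳ-≤; +-suc; <-asym; <-cmp; <-irrefl; <-trans; <-≤-trans; <ᵇ⇒<; <⇒<ᵇ; <⇒≱; m+[n∸m]≡n; m≤m+n; m≤n+m; n<1+n; n≮0; ∸-monoˡ-≤; ≡ᵇ⇒≡; ≤-antisym; ≤-pred; ≤-refl; ≤-reflexive; ≤-trans; ≰⇒>; module ≤-Reasoning)
open import Data.Nat.Solver using (module +-*-Solver)
open import Data.Product using (_×_; ∃-syntax; _,_; proj₁; proj₂)
open import Data.Sum using (_⊎_; inj₁; inj₂; [_,_]′)
open import Data.Unit using (tt)
open import Function using (_∘_; id; case_of_)
open import Relation.Binary.Definitions using (tri<; tri≈; tri>)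
open import Relation.Binary.PropositionalEquality as ≡ using (_≡_; _≢_; refl; cong; cong₂; subst; subst₂; module ≡-Reasoning)
open import Relation.Nullary using (¬_; Dec; yes; no; ¬?)
open import Relation.Nullary.Decidable using (_×-dec_)

-- The bound `6 ≤ n` comes from a pigeonhole step: the legs of a theta graph have at least
-- `n + 1 ≥ 7` edges together, so one of them has length at least 3 and its second edge is not an
-- end edge. A rainbow path that skips just this edge carries both end edges of its leg and so
-- compares their colours with each other and with a second leg. For `n = 5` the bound fails:
-- K_{2,3} with colours 1, 2, 3 at one branch vertex and 2, 3, 1 at the other, over the same order
-- of the middle vertices, is rainbow 2-connected with `n - 2` colours and `n + 1` edges. The
-- obstacle is that a forced path may return along either of two legs, and nothing tells which. The
-- skipping lemmas therefore yield an unspecified leg `l`, and the choice of the `n - 1` colours has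
-- to cope with every answer.

module _ {A : Set} where

  Disjoint : List A → List A → Set
  Disjoint xs ys = ∀ {x} → x ∈ xs → x ∈ ys → ⊥

  Unique-resp-↭ : ∀ {xs ys : List A} → xs ↭ ys → Unique xs → Unique ys
  Unique-resp-↭ p = Permutation.Unique-resp-↭ (≡.setoid A) (↭⇒↭ₛ p)

  unique-∷ : ∀ {x : A} {xs} → x ∉ xs → Unique xs → Unique (x ∷ xs)
  unique-∷ x∉ u = All.tabulate (λ { y∈ refl → x∉ y∈ }) ∷ u

  unique-++ : ∀ {xs ys : List A} → Unique xs → Unique ys → Disjoint xs ys → Unique (xs ++ ys)
  unique-++ u v d = Unique.++⁺ u v (λ { (a , b) → d a b })

  unique-++ˡ : ∀ xs {ys : List A} → Unique (xs ++ ys) → Unique xs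
  unique-++ˡ []       u       = []
  unique-++ˡ (x ∷ xs) (p ∷ u) = All.++⁻ˡ xs p ∷ unique-++ˡ xs u

  unique-++ʳ : ∀ xs {ys : List A} → Unique (xs ++ ys) → Unique ys
  unique-++ʳ []       u       = u
  unique-++ʳ (x ∷ xs) (p ∷ u) = unique-++ʳ xs u

  unique-++-disjoint : ∀ xs {ys : List A} → Unique (xs ++ ys) → Disjoint xs ys
  unique-++-disjoint (x ∷ xs) u (here refl) y∈ = unique-head∉ u (∈-++⁺ʳ xs y∈)
  unique-++-disjoint (x ∷ xs) u (there x∈)  y∈ = unique-++-disjoint xs (unique-tail u) x∈ y∈

  lookup-injective : ∀ {xs : List A} → Unique xs → ∀ {i j} → lookup xs i ≡ lookup xs j → i ≡ j
  lookup-injective {x ∷ xs} u {Fin.zero}  {Fin.zero}  eq = refl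
  lookup-injective {x ∷ xs} u {Fin.zero}  {Fin.suc j} eq = ⊥-elim (unique-head∉ u (subst (_∈ xs) (≡.sym eq) (∈-lookup j)))
  lookup-injective {x ∷ xs} u {Fin.suc i} {Fin.zero}  eq = ⊥-elim (unique-head∉ u (subst (_∈ xs) eq (∈-lookup i)))
  lookup-injective {x ∷ xs} u {Fin.suc i} {Fin.suc j} eq = cong Fin.suc (lookup-injective (unique-tail u) eq)

length-unique≤ : ∀ {r} {xs : List (Fin r)} → Unique xs → length xs ≤ r
length-unique≤ u = injective⇒≤ (lookup-injective u)

≤length-covering : ∀ {n} (xs : List (Fin n)) → (∀ v → v ∈ xs) → n ≤ length xs
≤length-covering xs cov = injective⇒≤ {f = λ v → Any.index (cov v)} λ {v} {w} eq →
  ≡.trans (lookup-index (cov v)) (≡.trans (cong (lookup xs) eq) (≡.sym (lookup-index (cov w))))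

-- Walks and threads

module _ {n : ℕ} (G : Graph n) where

  -- A walk is recorded by the list of its vertices after the first one.
  data Walk : Fin n → List (Fin n) → Fin n → Set where
    []  : ∀ {v} → Walk v [] v
    _∷_ : ∀ {u w v L} → Adj G u w → Walk w L v → Walk u (w ∷ L) v

  Path : Fin n → List (Fin n) → Fin n → Set
  Path u L v = Walk u L v × Unique (u ∷ L)

  -- Degree at most 2, stated so that the third neighbour is identified with a known one.
  Two : Fin n → Set
  Two w = ∀ {a b c} → Adj G w a → Adj G w b → Adj G w c → a ≢ b → a ≢ c → b ≡ c

  Branch : Fin n → Set
  Branch x = ∃[ a ] ∃[ b ] ∃[ c ] (Adj G x a × Adj G x b × Adj G x c × a ≢ b × a ≢ c × b ≢ c)

  Adj-sym : ∀ {u v} → Adj G u v → Adj G v u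
  Adj-sym {u} {v} e = ≡.trans (Graph.sym G v u) e

  Adj-irrefl : ∀ {u v} → Adj G u v → u ≢ v
  Adj-irrefl {u} e refl with ≡.trans (≡.sym e) (irrefl G u)
  ... | ()

-- reversal of a walk from u, again without its first vertex
rv : ∀ {A : Set} → A → List A → List A
rv u []      = []
rv u (w ∷ L) = rv w L ++ u ∷ []

module _ {n : ℕ} {G : Graph n} where

  chain⇒walk : ∀ {u v} M → Chain G (u ∷ M ++ v ∷ []) → Walk G u (M ++ v ∷ []) v
  chain⇒walk []      (e , _) = e ∷ []
  chain⇒walk (w ∷ M) (e , c) = e ∷ chain⇒walk M c

  walk⇒chain : ∀ {u L v} → Walk G u L v → Chain G (u ∷ L)
  walk⇒chain []              = tt
  walk⇒chain (e ∷ [])        = e , tt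
  walk⇒chain (e ∷ w@(_ ∷ _)) = e , walk⇒chain w

  walk-last : ∀ {u w L v} → Walk G u (w ∷ L) v → ∃[ M ] w ∷ L ≡ M ++ v ∷ []
  walk-last (e ∷ [])            = [] , refl
  walk-last (_∷_ {w = w} e p@(_ ∷ _)) with walk-last p
  ... | M , eq = w ∷ M , cong (w ∷_) eq

  walk-end∈ : ∀ {u L v} → Walk G u L v → v ∈ u ∷ L
  walk-end∈ []      = here refl
  walk-end∈ (e ∷ p) = there (walk-end∈ p)

  walk-end∈tail : ∀ {u L v} → Walk G u L v → u ≢ v → v ∈ L
  walk-end∈tail []      ne = ⊥-elim (ne refl)
  walk-end∈tail (e ∷ p) _  = walk-end∈ p

  _⊕_ : ∀ {u w v L M} → Walk G u L w → Walk G w M v → Walk G u (L ++ M) v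
  []      ⊕ q = q
  (e ∷ p) ⊕ q = e ∷ (p ⊕ q)

  loop-trivial : ∀ {u L v} → Walk G u L v → Unique (u ∷ L) → u ≡ v → L ≡ []
  loop-trivial []      _ _    = refl
  loop-trivial (e ∷ p) u refl = ⊥-elim (unique-head∉ u (walk-end∈ p))

  walk-rv : ∀ {u L v} → Walk G u L v → Walk G v (rv u L) u
  walk-rv []      = []
  walk-rv (e ∷ p) = walk-rv p ⊕ (Adj-sym G e ∷ [])

  rv-↭ : ∀ {u L v} → Walk G u L v → v ∷ rv u L ↭ u ∷ L
  rv-↭ []                          = ↭-refl
  rv-↭ {u} {v = v} (_∷_ {w = w} {L = L} e p) = ↭-trans (++⁺ʳ (u ∷ []) (rv-↭ p)) (↭-sym (∷↭∷ʳ u (w ∷ L)))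

  path-rv : ∀ {u L v} → Path G u L v → Path G v (rv u L) u
  path-rv (p , u) = walk-rv p , Unique-resp-↭ (↭-sym (rv-↭ p)) u

  rv-∈ : ∀ {u L v w} → Walk G u L v → w ∈ rv u L → w ∈ u ∷ L
  rv-∈ p w∈ = ∈-resp-↭ (rv-↭ p) (there w∈)

  rv-++ : ∀ {u w L} M → Walk G u L w → rv u (L ++ M) ≡ rv w M ++ rv u L
  rv-++ M []                          = ≡.sym (++-identityʳ _)
  rv-++ {u} {w} M (_∷_ {w = x} {L = L} e p) =
    ≡.trans (cong (_++ u ∷ []) (rv-++ M p)) (++-assoc (rv w M) (rv x L) (u ∷ []))

  rv-rv : ∀ {u L v} → Walk G u L v → rv v (rv u L) ≡ L
  rv-rv []                                   = refl
  rv-rv {u} {v = v} (_∷_ {w = w} {L = L} e p) =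
    ≡.trans (rv-++ (u ∷ []) (walk-rv p)) (cong (w ∷_) (rv-rv p))

  -- Closure is asked only for steps into vertices of `L`, so that `S` may be closed merely outside
  -- a vertex which the walk avoids.
  closed-reach : ∀ (S : Fin n → Set) {u L v} → (∀ {s t} → S s → Adj G s t → t ∈ L → S t) →
                 Walk G u L v → S u → S v
  closed-reach S cl []      su = su
  closed-reach S cl (e ∷ p) su = closed-reach S (λ s a t∈ → cl s a (there t∈)) p (cl su e (here refl))

  -- At each inner vertex of the thread, the vertex just left and the next one on the thread are two
  -- distinct neighbours, so the path must continue along the thread. The last hypothesis keeps it
  -- from ending before `z`.
  follow : ∀ {u t T z L v} → Walk G u (t ∷ T) z → Unique (u ∷ t ∷ T) →
           (∀ {w} → w ∈ t ∷ T → w ≢ z → Two G w) →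
           Walk G u (t ∷ L) v → Unique (u ∷ t ∷ L) →
           (v ∈ t ∷ T → v ≡ z) →
           ∃[ R ] (L ≡ T ++ R × Walk G z R v)
  follow (_ ∷ []) _ _ (_ ∷ q) _ _ = _ , refl , q
  follow (e ∷ p@(_ ∷ p′)) uT two (_ ∷ []) uL v∉ with v∉ (here refl)
  ... | refl = ⊥-elim (unique-head∉ (unique-tail uT) (walk-end∈ p′))
  follow {u} {t} {t′ ∷ T} {z} (e ∷ p@(e₁ ∷ p₁)) uT two (_ ∷ q@(_∷_ {w = l} e₂ q₂)) uL v∉
    with two (here refl) (λ { refl → unique-head∉ (unique-tail uT) (walk-end∈ p₁) })
             (Adj-sym G e) e₁ e₂ (λ { refl → unique-head∉ uT (there (here refl)) }) (λ { refl → unique-head∉ uL (there (here refl)) })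
  ... | refl with follow p (unique-tail uT) (two ∘ there) q (unique-tail uL) (v∉ ∘ there)
  ... | R , eq , r = R , cong (t′ ∷_) eq , r

  thread-nbr : ∀ {u A y t s} → Walk G u A y → Unique (u ∷ A) → t ∈ A → t ≢ y → Two G t → Adj G t s →
               s ∈ A ⊎ (s ≡ u × ∃[ A′ ] A ≡ t ∷ A′)
  thread-nbr {u} {s = s} (e ∷ []) uA (here refl) t≢y two a = ⊥-elim (t≢y refl)
  thread-nbr {u} {s = s} (e ∷ (e₁ ∷ p)) uA (here refl) t≢y two a with s ≟ᶠ u
  ... | yes s≡u = inj₂ (s≡u , _ , refl)
  ... | no s≢u = inj₁ (there (here (≡.sym (two (Adj-sym G e) e₁ a (λ { refl → unique-head∉ uA (there (here refl)) }) (s≢u ∘ ≡.sym)))))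
  thread-nbr (e ∷ p) uA (there t∈) t≢y two a with thread-nbr p (unique-tail uA) t∈ t≢y two a
  ... | inj₁ s∈          = inj₁ (there s∈)
  ... | inj₂ (refl , _)  = inj₁ (here refl)

  pred : ∀ {u L v} → Walk G u L v → u ≢ v → ∃[ l ] (l ∈ u ∷ L × Adj G l v)
  pred []                     ne = ⊥-elim (ne refl)
  pred {u} {v = v} (_∷_ {w = w} e p) ne with w ≟ᶠ v
  ... | yes refl = u , here refl , e
  ... | no w≢v with pred p w≢v
  ... | l , l∈ , a = l , there l∈ , a

  -- Disjointness follows from the degrees alone. On the way along `C` from `x`, the first vertex of
  -- `A` other than `y` could be entered only from `A` itself or from `x` at `a`; the former
  -- contradicts being first, the latter `a ≢ c`.
  threads-disjoint : ∀ {x y A C a c A′ C′} → A ≡ a ∷ A′ → C ≡ c ∷ C′ → a ≢ c →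
                     Path G x A y → Path G x C y → (∀ {w} → w ≢ x → w ≢ y → Two G w) →
                     ∀ {w} → w ∈ A → w ∈ C → w ≡ y
  threads-disjoint {x} {y} {A} {a = a} {c = c} refl refl a≢c (pA , uA) (eC ∷ pC , uC) two wA wC =
    go (eC ∷ pC) (unique-tail uC)
      (λ c≢y c∈ → [ unique-head∉ uA , (λ { (_ , refl) → a≢c refl }) ]′ (enter c∈ c≢y eC)) (unique-head∉ uC) wC wA
    where
    enter : ∀ {s t} → t ∈ A → t ≢ y → Adj G s t → s ∈ A ⊎ (s ≡ x × t ≡ a)
    enter t∈ t≢y e with thread-nbr pA uA t∈ t≢y (two (λ { refl → unique-head∉ uA t∈ }) t≢y) (Adj-sym G e)
    ... | inj₁ s∈               = inj₁ s∈
    ... | inj₂ (s≡x , _ , refl) = inj₂ (s≡x , refl)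

    go : ∀ {s t T w} → Walk G s (t ∷ T) y → Unique (t ∷ T) → (t ≢ y → t ∉ A) → x ∉ t ∷ T →
         w ∈ t ∷ T → w ∈ A → w ≡ y
    go {t = t} (e ∷ p) u t∉ x∉ w∈ w∈A with t ≟ᶠ y
    go (e ∷ p) u t∉ x∉ (here refl) w∈A | yes t≡y = t≡y
    go (e ∷ p) u t∉ x∉ (there w∈)  w∈A | yes t≡y with loop-trivial p u t≡y
    go (e ∷ p) u t∉ x∉ (there ())  w∈A | yes t≡y | refl
    go (e ∷ p) u t∉ x∉ (here refl) w∈A | no t≢y = ⊥-elim (t∉ t≢y w∈A)
    go (e ∷ p@(e₁ ∷ _)) u t∉ x∉ (there w∈) w∈A | no t≢y =
      go p (unique-tail u) (λ t₁≢y t₁∈ → [ t∉ t≢y , (λ { (refl , _) → x∉ (here refl) }) ]′ (enter t₁∈ t₁≢y e₁)) (x∉ ∘ there) w∈ w∈A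

  -- The vertex `u` may have further neighbours, so this serves both a whole cycle and a cycle
  -- through a lone branch vertex. The end `v` is treated apart: its neighbours are its predecessor
  -- and, by the closing edge, `u`.
  cycle-closed : ∀ {u w L v} → Path G u (w ∷ L) v → w ≢ v → Adj G v u → (∀ {t} → t ∈ w ∷ L → Two G t) →
                 ∀ {t s} → t ∈ w ∷ L → Adj G t s → s ∈ w ∷ L ⊎ s ≡ u
  cycle-closed {u} {w} {L} {v} (p@(_ ∷ p′) , uL) w≢v vu two {t} {s} t∈ ts with t ≟ᶠ v
  ... | no t≢v with thread-nbr p uL t∈ t≢v (two t∈) ts
  ...   | inj₁ s∈        = inj₁ s∈
  ...   | inj₂ (s≡u , _) = inj₂ s≡u
  cycle-closed {u} {w} {L} {v} (p@(_ ∷ p′) , uL) w≢v vu two {t} {s} t∈ ts | yes refl with s ≟ᶠ u | pred p′ w≢v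
  ... | yes s≡u | _ = inj₂ s≡u
  ... | no s≢u  | l , l∈ , a =
    inj₁ (subst (_∈ _) (two t∈ vu (Adj-sym G a) ts (λ { refl → unique-head∉ uL l∈ }) (s≢u ∘ ≡.sym)) l∈)

-- Rainbow paths and pairs of disjoint ones

module _ {n r : ℕ} {G : Graph n} (c : Colouring G r) where

  cols : Fin n → List (Fin n) → List (Fin r)
  cols u L = edgeColours c (u ∷ L)

  RPath : Fin n → List (Fin n) → Fin n → Set
  RPath u L v = Path G u L v × Unique (cols u L)

  -- Both lists end in `v`, so disjointness becomes meeting only in `v`. Without `L ≢ M` the edge
  -- `uv` taken twice would qualify.
  Pair : Fin n → Fin n → Set
  Pair u v = ∃[ L ] ∃[ M ] (RPath u L v × RPath u M v × L ≢ M × (∀ {w} → w ∈ L → w ∈ M → w ≡ v))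

  Fork : Fin n → Fin n → Fin n → Fin n → Set
  Fork u a b v = ∃[ L ] ∃[ M ] (RPath u (a ∷ L) v × RPath u (b ∷ M) v × (∀ {w} → w ∈ a ∷ L → w ∈ b ∷ M → w ≡ v))

  length-cols : ∀ u L → length (cols u L) ≡ length L
  length-cols u []      = refl
  length-cols u (w ∷ L) = cong suc (length-cols w L)

  cols-++ : ∀ {u L w} M → Walk G u L w → cols u (L ++ M) ≡ cols u L ++ cols w M
  cols-++ M []                = refl
  cols-++ {u} M (_∷_ {w = w} e p) = cong (col c u w ∷_) (cols-++ M p)

  cols-rv : ∀ {u L v} → Walk G u L v → cols v (rv u L) ↭ cols u L
  cols-rv []                               = ↭-refl
  cols-rv {u} {v = v} (_∷_ {w = w} {L = L} e p) = begin
    cols v (rv w L ++ u ∷ [])         ≡⟨ cols-++ (u ∷ []) (walk-rv p) ⟩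
    cols v (rv w L) ++ col c w u ∷ [] ↭⟨ ++⁺ʳ _ (cols-rv p) ⟩
    cols w L ++ col c w u ∷ []        ↭⟨ ↭-sym (∷↭∷ʳ _ (cols w L)) ⟩
    col c w u ∷ cols w L              ≡⟨ cong (_∷ cols w L) (colSym c w u) ⟩
    col c u w ∷ cols w L              ∎
    where open PermutationReasoning

  rpath-rv : ∀ {u L v} → RPath u L v → RPath v (rv u L) u
  rpath-rv (p@(w , _) , u) = path-rv p , Unique-resp-↭ (↭-sym (cols-rv w)) u

  pairs : Rainbow2Connected c → ∀ {u v} → u ≢ v → Pair u v
  pairs rc {u} {v} u≢v with rc u v u≢v
  ... | m , m′ , ((ch , un) , cu) , ((ch′ , un′) , cu′) , m≢m′ , dis =
    m ++ v ∷ [] , m′ ++ v ∷ [] , ((chain⇒walk m ch , un) , cu) , ((chain⇒walk m′ ch′ , un′) , cu′) ,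
    (λ eq → m≢m′ (∷ʳ-injectiveˡ m m′ eq)) , meet
    where
    meet : ∀ {w} → w ∈ m ++ v ∷ [] → w ∈ m′ ++ v ∷ [] → w ≡ v
    meet w∈ w∈′ with ∈-++⁻ m w∈ | ∈-++⁻ m′ w∈′
    ... | inj₂ (here eq) | _              = eq
    ... | inj₁ _         | inj₂ (here eq) = eq
    ... | inj₁ a         | inj₁ b         = ⊥-elim (dis _ a b)

  MidPair : Fin n → Fin n → Set
  MidPair u v = ∃[ mid₁ ] ∃[ mid₂ ]
    ( RainbowPath c u mid₁ v × RainbowPath c u mid₂ v × mid₁ ≢ mid₂ × (∀ x → x ∈ mid₁ → x ∉ mid₂))

  pair⇒mids : ∀ {u v} → u ≢ v → Pair u v → MidPair u v
  pair⇒mids u≢v ([]    , _ , (([] , _) , _) , _) = ⊥-elim (u≢v refl)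
  pair⇒mids u≢v (_ ∷ _ , [] , _ , (([] , _) , _) , _) = ⊥-elim (u≢v refl)
  pair⇒mids {u} {v} u≢v (_ ∷ _ , _ ∷ _ , P@((p , _) , _) , Q@((q , _) , _) , ne , meet)
    with walk-last p | walk-last q
  ... | m , eq | m′ , eq′ = go eq eq′ P Q ne meet
    where
    go : ∀ {L M m m′} → L ≡ m ++ v ∷ [] → M ≡ m′ ++ v ∷ [] → RPath u L v → RPath u M v → L ≢ M →
         (∀ {w} → w ∈ L → w ∈ M → w ≡ v) → MidPair u v
    go {m = m} {m′} refl refl ((p , un) , cu) ((p′ , un′) , cu′) ne meet =
      m , m′ , ((walk⇒chain p , un) , cu) , ((walk⇒chain p′ , un′) , cu′) , (λ { refl → ne refl }) ,
      λ x x∈ x∈′ → unique-++-disjoint m (unique-tail un) x∈ (here (meet (∈-++⁺ˡ x∈) (∈-++⁺ˡ x∈′)))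

  -- A common first vertex would have to be `v`, and then both paths would be the same edge.
  fork : ∀ {u v} → u ≢ v → Pair u v → ∃[ a ] ∃[ b ] (a ≢ b × Fork u a b v)
  fork u≢v ([]    , _ , (([] , _) , _) , _) = ⊥-elim (u≢v refl)
  fork u≢v (_ ∷ _ , [] , _ , (([] , _) , _) , _) = ⊥-elim (u≢v refl)
  fork {u} {v} u≢v (a ∷ L , b ∷ M , P@((_ ∷ p , (_ ∷ u₁)) , _) , Q@((_ ∷ q , (_ ∷ u₂)) , _) , ne , meet) =
    a , b , a≢b , L , M , P , Q , meet
    where
    a≢b : a ≢ b
    a≢b refl with meet (here refl) (here refl)
    ... | a≡v with loop-trivial p u₁ a≡v | loop-trivial q u₂ a≡v
    ... | refl | refl = ne refl

  fork-sym : ∀ {u a b v} → Fork u a b v → Fork u b a v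
  fork-sym (L , M , P , Q , meet) = M , L , Q , P , λ a b → meet b a

  -- The two paths leave `u` along different edges, hence along both of its edges. This is how a
  -- first step can be prescribed.
  fork-at : ∀ {u v a b} → u ≢ v → Pair u v → Two G u → Adj G u a → Adj G u b → a ≢ b → Fork u a b v
  fork-at {u} {v} {a} {b} u≢v pr two ua ub a≢b with fork u≢v pr
  ... | a′ , b′ , a′≢b′ , F@(_ , _ , ((ua′ ∷ _ , _) , _) , ((ub′ ∷ _ , _) , _) , _) with a′ ≟ᶠ a
  ...   | yes refl with two ua ub ub′ a≢b a′≢b′
  ...     | refl = F
  fork-at {u} {v} {a} {b} u≢v pr two ua ub a≢b | a′ , b′ , a′≢b′ , F@(_ , _ , ((ua′ ∷ _ , _) , _) , ((ub′ ∷ _ , _) , _) , _) | no a′≢a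
    with two ua ub ua′ a≢b (a′≢a ∘ ≡.sym) 
  ...     | refl with two ua′ ua ub′ a′≢a a′≢b′
  ...       | refl = fork-sym F

-- Cycles and single branch vertices

module _ {n r : ℕ} {G : Graph n} (c : Colouring G r) (rc : Rainbow2Connected c) where

  two-neighbours : ∀ {u v} → u ≢ v → ∃[ a ] ∃[ b ] (a ≢ b × Adj G u a × Adj G u b)
  two-neighbours u≢v with fork c u≢v (pairs c rc u≢v)
  ... | a , b , a≢b , _ , _ , ((ua ∷ _ , _) , _) , ((ub ∷ _ , _) , _) , _ = a , b , a≢b , ua , ub

  covers : ∀ {u} (S : Fin n → Set) → S u → (∀ {s t} → S s → Adj G s t → S t) → ∀ v → S v
  covers {u} S su closed v with u ≟ᶠ v
  ... | yes refl = su
  ... | no u≢v with pairs c rc u≢v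
  ... | L , _ , ((p , _) , _) , _ = closed-reach S (λ s a _ → closed s a) p su

  cycle-colours : ∀ {u v} → u ≢ v → (∀ w → Two G w) → n ≤ r
  cycle-colours {u} u≢v two with two-neighbours u≢v
  -- The path from `u` to its neighbour `p` that starts with `q` turns out to pass through every
  -- vertex.
  ... | p , q , p≢q , up , uq with fork-at c (Adj-irrefl G up) (pairs c rc (Adj-irrefl G up)) (two u) uq up (p≢q ∘ ≡.sym)
  ... | [] , _ , ((_ ∷ [] , _) , _) , _ = ⊥-elim (p≢q refl)
  ... | L@(q₂ ∷ L₂) , _ , ((uq′ ∷ P@(qq₂ ∷ _) , uL) , cL) , _ , _ = begin
    n                           ≤⟨ ≤length-covering (u ∷ q ∷ L) (covers (_∈ u ∷ q ∷ L) (here refl) closed) ⟩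
    2 + length L                ≡⟨ cong suc (length-cols c u (q ∷ L)) ⟨
    suc (length (cols c u (q ∷ L))) ≤⟨ length-unique≤ (unique-∷ κ∉ cL) ⟩
    r                           ∎
    where
    open ≤-Reasoning
    closed : ∀ {s t} → s ∈ u ∷ q ∷ L → Adj G s t → t ∈ u ∷ q ∷ L
    closed {t = t} (here refl) a with q ≟ᶠ t
    ... | yes refl = there (here refl)
    ... | no q≢t with two u uq up a (p≢q ∘ ≡.sym) q≢t
    ... | refl = there (walk-end∈ P)
    closed (there s∈) a with cycle-closed (uq ∷ P , uL) (p≢q ∘ ≡.sym) (Adj-sym G up) (λ {t} _ → two t) s∈ a
    ... | inj₁ t∈   = there t∈
    ... | inj₂ refl = here refl
    κ∉ : col c u p ∉ cols c u (q ∷ L)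
    -- Suppose `up` and `uq` have the same colour. The path from `q` to `q₂` that starts with `u`
    -- must go on to `p` and so uses both edges.
    κ∉ (here eq) with fork-at c (Adj-irrefl G qq₂) (pairs c rc (Adj-irrefl G qq₂)) (two q) (Adj-sym G uq) qq₂
                        (λ { refl → unique-head∉ uL (there (here refl)) })
    ... | [] , _ , ((_ ∷ [] , _) , _) , _ = unique-head∉ uL (there (here refl))
    ... | m ∷ M , _ , ((_ ∷ um ∷ _ , uM) , cM) , _ with two u uq up um (p≢q ∘ ≡.sym) (λ { refl → unique-head∉ uM (there (here refl)) })
    ... | refl = unique-head∉ cM (here (≡.trans (colSym c q u) (≡.sym eq)))
    -- Otherwise the path from `u` to `q` that starts with `p` uses `up` and then all of `P`
    -- backwards, including the edge with the same colour.
    κ∉ (there κ∈) with fork-at c (Adj-irrefl G uq) (pairs c rc (Adj-irrefl G uq)) (two u) up uq p≢q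
    ... | M , _ , ((w@(_ ∷ _) , uM) , cM) , _
      with follow (up ∷ walk-rv P) (Unique-resp-↭ (prep u (↭-sym (rv-↭ P))) uL) (λ {t} _ _ → two t) w uM (λ _ → refl)
    ... | R , refl , _ = unique-head∉ cM (subst (_ ∈_) (≡.sym (cols-++ c R (walk-rv P))) (∈-++⁺ˡ (∈-resp-↭ (↭-sym (cols-rv c P)) κ∈)))

  -- Two neighbours `p`, `q` of `x` lie with it on a cycle whose other vertices have degree 2. A
  -- path from `p` to a third neighbour `s` that avoids `x` cannot leave this cycle, but on it only
  -- `p` and `q` are adjacent to `x`.
  second-branch : ∀ {x} → TwoConnected G → Branch G x → ¬ (∀ {w} → w ≢ x → Two G w)
  second-branch {x} (_ , _ , cut) (p , q , s , xp , xq , xs , p≢q , p≢s , q≢s) two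
    with cut x p q p≢q (Adj-irrefl G (Adj-sym G xp)) (Adj-irrefl G (Adj-sym G xq)) | cut x p s p≢s (Adj-irrefl G (Adj-sym G xp)) (Adj-irrefl G (Adj-sym G xs))
  ... | M , (chM , uM) , x∉M | N , (chN , uN) , x∉N = s∉ s∈
    where
    S = p ∷ M ++ q ∷ []
    pM : Walk G p (M ++ q ∷ []) q
    pM = chain⇒walk M chM
    x∉ : ∀ {K t} → x ∉ K → Adj G x t → x ∉ K ++ t ∷ []
    x∉ {K} x∉K xt x∈ with ∈-++⁻ K x∈
    ... | inj₁ a = x∉K a
    ... | inj₂ (here refl) = Adj-irrefl G xt refl
    x∉S : x ∉ S
    x∉S (here refl) = Adj-irrefl G xp refl
    x∉S (there a)   = x∉ x∉M xq a
    pathS : Path G x S q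
    pathS = xp ∷ pM , unique-∷ x∉S uM
    twoS : ∀ {t} → t ∈ S → Two G t
    twoS t∈ = two (λ { refl → x∉S t∈ })
    closed : ∀ {t t′} → t ∈ S → Adj G t t′ → t′ ∈ N ++ s ∷ [] → t′ ∈ S
    closed t∈ a t′∈ with cycle-closed pathS p≢q (Adj-sym G xq) twoS t∈ a
    ... | inj₁ t′∈S = t′∈S
    ... | inj₂ refl = ⊥-elim (x∉ x∉N xs t′∈)
    s∈ : s ∈ S
    s∈ = closed-reach (_∈ S) closed (chain⇒walk N chN) (here refl)
    s∉ : s ∉ S
    s∉ s∈ with thread-nbr (proj₁ pathS) (proj₂ pathS) s∈ (q≢s ∘ ≡.sym) (twoS s∈) (Adj-sym G xs)
    ... | inj₁ x∈ = x∉S x∈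
    ... | inj₂ (_ , _ , refl) = p≢s refl

-- Theta graphs

Head : ∀ {A : Set} → List A → A → Set
Head T d = ∃[ T′ ] T ≡ d ∷ T′

head∈ : ∀ {A : Set} {T : List A} {d} → Head T d → d ∈ T
head∈ (_ , refl) = here refl

head-++ : ∀ {A : Set} {S T : List A} {s d} → s ∈ S → Head (S ++ T) d → Head S d
head-++ {S = _ ∷ S} s∈ (_ , refl) = S , refl

-- A leg lists its vertices after `x`, so every leg contains `y` and `disjoint` has to except it;
-- `distinct` forbids two copies of the edge `xy`. By `exit` and `exit′` every edge at a branch
-- vertex starts a leg, which together with `two` leaves no edge out of the legs.
record Theta {n} (G : Graph n) (x y : Fin n) : Set where
  field
    leg      : Fin 3 → List (Fin n)
    path     : ∀ i → Path G x (leg i) y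
    x≢y      : x ≢ y
    two      : ∀ {w} → w ≢ x → w ≢ y → Two G w
    disjoint : ∀ {i j w} → i ≢ j → w ∈ leg i → w ∈ leg j → w ≡ y
    distinct : ∀ {i j} → i ≢ j → leg i ≢ leg j
    exit     : ∀ {d} → Adj G x d → ∃[ i ] Head (leg i) d
    exit′    : ∀ {d} → Adj G y d → ∃[ i ] Head (rv x (leg i)) d

  walk : ∀ i → Walk G x (leg i) y
  walk i = proj₁ (path i)

  y∈leg : ∀ i → y ∈ leg i
  y∈leg i = walk-end∈tail (walk i) x≢y

  x∉leg : ∀ i → x ∉ leg i
  x∉leg i = unique-head∉ (proj₂ (path i))

  x∈rv : ∀ i → x ∈ rv x (leg i)
  x∈rv i = walk-end∈tail (walk-rv (walk i)) (x≢y ∘ ≡.sym)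

  y∉rv : ∀ i → y ∉ rv x (leg i)
  y∉rv i = unique-head∉ (proj₂ (path-rv (path i)))

  rv-leg : ∀ i {w} → w ∈ rv x (leg i) → w ∈ x ∷ leg i
  rv-leg i = rv-∈ (walk i)

-- Carries results about the ends of legs at `x` over to the ends at `y`.
flip : ∀ {n} {G : Graph n} {x y} → Theta G x y → Theta G y x
flip {x = x} {y} Θ = record
  { leg      = λ i → rv x (leg i)
  ; path     = λ i → path-rv (path i)
  ; x≢y      = x≢y ∘ ≡.sym
  ; two      = λ a b → two b a
  ; disjoint = λ {i} {j} i≢j wi wj → meet i≢j wi wj (rv-leg i wi) (rv-leg j wj)
  ; distinct = λ {i} {j} i≢j eq → distinct i≢j (≡.trans (≡.sym (rv-rv (walk i))) (≡.trans (cong (rv y) eq) (rv-rv (walk j))))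
  ; exit     = exit′
  ; exit′    = λ a → case exit a of λ { (i , h) → i , subst (λ T → Head T _) (≡.sym (rv-rv (walk i))) h }
  }
  where
  open Theta Θ
  meet : ∀ {i j w} → i ≢ j → w ∈ rv x (leg i) → w ∈ rv x (leg j) → w ∈ x ∷ leg i → w ∈ x ∷ leg j → w ≡ x
  meet i≢j _ _ (here eq)  _          = eq
  meet i≢j _ _ (there _)  (here eq)  = eq
  meet {i} i≢j wi _ (there a) (there b) with disjoint i≢j a b
  ... | refl = ⊥-elim (y∉rv i wi)

module _ {n} {G : Graph n} where

  follow-leg : ∀ {u T z R v d} → Path G u T z → (∀ {w} → w ∈ T → w ≢ z → Two G w) →
               Head T d → Path G u (d ∷ R) v → (v ∈ T → v ≡ z) → ∃[ R′ ] (d ∷ R ≡ T ++ R′ × Walk G z R′ v)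
  follow-leg (p , uT) two (T′ , refl) (q , uR) v∉ with follow p uT two q uR v∉
  ... | R′ , refl , r = R′ , refl , r

  module _ {x y} (Θ : Theta G x y) where
    open Theta Θ

    follow-forth : ∀ {R v d} i → Head (leg i) d → Path G x (d ∷ R) v → (v ∈ leg i → v ≡ y) →
                   ∃[ R′ ] (d ∷ R ≡ leg i ++ R′ × Walk G y R′ v)
    follow-forth i = follow-leg (path i) λ w∈ → two (λ { refl → x∉leg i w∈ })

    follow-back : ∀ {R v d} i → Head (rv x (leg i)) d → Path G y (d ∷ R) v → (v ∈ rv x (leg i) → v ≡ x) →
                  ∃[ R′ ] (d ∷ R ≡ rv x (leg i) ++ R′ × Walk G x R′ v)
    follow-back i = follow-leg (path-rv (path i)) λ w∈ w≢x → two w≢x (λ { refl → y∉rv i w∈ })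

    sub-leg : ∀ {i p A} → leg i ≡ p ∷ A → Adj G x p × Path G p A y
    sub-leg {i} eq with leg i | path i
    sub-leg refl | _ | (e ∷ p , u) = e , p , unique-tail u

    inner : ∀ {i p A} → leg i ≡ p ∷ A → p ≢ y → ∀ {w} → w ∈ p ∷ A → w ≢ y → Two G w
    inner {i} eq p≢y w∈ = two (λ { refl → x∉leg i (subst (_ ∈_) (≡.sym eq) w∈) })

    ∈leg : ∀ {i L w} → leg i ≡ L → w ∈ L → w ∈ leg i
    ∈leg eq = subst (_ ∈_) (≡.sym eq)

    head-back : ∀ {i p A d} → leg i ≡ p ∷ A → p ≢ y → Head (rv x (leg i)) d → Head (rv p A) d
    head-back {A = A} eq p≢y h with sub-leg eq
    ... | _ , p , _ rewrite eq = head-++ (walk-end∈tail (walk-rv p) (p≢y ∘ ≡.sym)) h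

  path-suffix : ∀ {u A y R v} → Walk G u A y → Walk G y R v → Unique (u ∷ A ++ R) → Path G y R v
  path-suffix {u} {A} p q un = q , unique-∷ (unique-++-disjoint (u ∷ A) un (walk-end∈ p)) (unique-++ʳ (u ∷ A) un)

  module _ {r} (c : Colouring G r) where

    cols-prefix : ∀ {u A y B z} R → Walk G u A y → Walk G y B z → Unique (cols c u (A ++ B ++ R)) →
                  Unique (cols c u A ++ cols c y B)
    cols-prefix {u} {A} {y} {B} {z} R p q un = unique-++ˡ (cols c u A ++ cols c y B) (subst Unique eq un)
      where
      eq : cols c u (A ++ B ++ R) ≡ (cols c u A ++ cols c y B) ++ cols c z R
      eq = ≡.trans (cols-++ c (B ++ R) p) (≡.trans (cong (cols c u A ++_) (cols-++ c R q)) (≡.sym (++-assoc (cols c u A) _ _)))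

  module _ {r} (c : Colouring G r) (rc : Rainbow2Connected c) {x y} (Θ : Theta G x y) where
    open Theta Θ

    -- Applied to the pair p, q: one path goes p, A, y, B reversed, q, since the other one uses x.
    cross : ∀ {i j p A q B} → i ≢ j → leg i ≡ p ∷ A → leg j ≡ q ∷ B → p ≢ y → q ≢ y →
            Unique (cols c p A ++ cols c q B)
    cross {i} {j} {p} {A} {q} {B} i≢j eqA eqB p≢y q≢y with sub-leg Θ eqA | sub-leg Θ eqB
    ... | xp , [] , _ | _ = ⊥-elim (p≢y refl)
    ... | xp , wA@(_∷_ {w = h} ph wA′) , uA | xq , wB , uB
      with fork-at c p≢q (pairs c rc p≢q) (inner Θ eqA p≢y (here refl) p≢y) ph (Adj-sym G xp) h≢x
      where
      p≢q : p ≢ q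
      p≢q refl = p≢y (disjoint i≢j (∈leg Θ eqA (here refl)) (∈leg Θ eqB (here refl)))
      h≢x : h ≢ x
      h≢x refl = x∉leg i (∈leg Θ eqA (there (here refl)))
    ... | M , _ , ((wM , uM) , cM) , _ , meet
      with follow wA uA (λ w∈ → inner Θ eqA p≢y (there w∈)) wM uM
             (λ q∈ → disjoint i≢j (∈leg Θ eqA (there q∈)) (∈leg Θ eqB (here refl)))
    ... | [] , refl , [] = ⊥-elim (q≢y refl)
    ... | d ∷ R , refl , wR@(yd ∷ _) with exit′ yd
    -- Leaving `y` along leg `i` would repeat a vertex, and the third leg would lead to `x`, where
    -- the other path of the fork starts.
    ... | l , hd with l Fin.≟ i | l Fin.≟ j
    ... | yes refl | _ = ⊥-elim (unique-++-disjoint (p ∷ A) uM (rv-∈ wA (head∈ (head-back Θ eqA p≢y hd))) (here refl))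
    ... | no _ | yes refl
      with follow-leg (path-rv (wB , uB)) (λ w∈ w≢q → inner Θ eqB q≢y (rv-∈ wB w∈) (λ { refl → unique-head∉ (proj₂ (path-rv (wB , uB))) w∈ }))
             (head-back Θ eqB q≢y hd) (path-suffix wA wR uM) (λ _ → refl)
    ... | R′ , e , _ = Unique-resp-↭ (++⁺ˡ (cols c p A) (cols-rv c wB))
                         (cols-prefix c R′ wA (walk-rv wB) (subst (λ S → Unique (cols c p (A ++ S))) e cM))
    cross {i} {j} {p} {A} {q} {B} i≢j eqA eqB p≢y q≢y
      | xp , wA@(_∷_ {w = h} ph wA′) , uA | xq , wB , uB | M , _ , ((wM , uM) , cM) , _ , meet | d ∷ R , refl , wR@(yd ∷ _) | l , hd | no _ | no l≢j
      with follow-back Θ l hd (path-suffix wA wR uM) q∉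
      where
      q∉ : q ∈ rv x (leg l) → q ≡ x
      q∉ q∈ with rv-leg l q∈
      ... | here eq   = eq
      ... | there q∈′ = ⊥-elim (q≢y (disjoint l≢j q∈′ (∈leg Θ eqB (here refl))))
    ... | R′ , eq , _ with meet (∈-++⁺ʳ A (subst (x ∈_) (≡.sym eq) (∈-++⁺ˡ (x∈rv l)))) (here refl)
    ... | refl = ⊥-elim (x∉leg j (∈leg Θ eqB (here refl)))

    -- Applied to the pair x, w: the path avoiding the edge xw returns to x through some other leg l.
    skip-first : ∀ {k w R} → leg k ≡ w ∷ R → w ≢ y → ∃[ l ] (l ≢ k × Unique (cols c w R ++ cols c x (leg l)))
    skip-first {k} {w} {R} eq w≢y with sub-leg Θ eq
    ... | xw , [] , _ = ⊥-elim (w≢y refl)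
    ... | xw , wR@(_∷_ {w = h} wh _) , uR
      with fork-at c w≢x (pairs c rc w≢x) (inner Θ eq w≢y (here refl) w≢y) wh (Adj-sym G xw) (λ { refl → x∉leg k (∈leg Θ eq (there (here refl))) })
      where
      w≢x : w ≢ x
      w≢x refl = x∉leg k (∈leg Θ eq (here refl))
    ... | K , _ , ((wK , uK) , cK) , _
      with follow wR uR (λ w∈ → inner Θ eq w≢y (there w∈)) wK uK (λ x∈ → ⊥-elim (x∉leg k (∈leg Θ eq (there x∈))))
    ... | [] , refl , [] = ⊥-elim (x≢y refl)
    ... | d ∷ K′ , refl , wK′@(yd ∷ _) with exit′ yd
    ... | l , hd with l Fin.≟ k
    ... | yes refl = ⊥-elim (unique-++-disjoint (w ∷ R) uK (rv-∈ wR (head∈ (head-back Θ eq w≢y hd))) (here refl))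
    ... | no l≢k with follow-back Θ l hd (path-suffix wR wK′ uK) (λ _ → refl)
    ... | K″ , e , _ = l , l≢k , Unique-resp-↭ (++⁺ˡ (cols c w R) (cols-rv c (walk l)))
                         (cols-prefix c K″ wR (walk-rv (walk l)) (subst (λ S → Unique (cols c w (R ++ S))) e cK))

    -- For the pair `v`, `w`, the path avoiding the edge `vw` starts with `x`, runs through some
    -- other leg `l` to `y` and comes back to `w` along leg `k`. So the cycle of legs `k` and `l` is
    -- rainbow apart from `vw`. If `w` is `y`, the way back is empty.
    skip-second : ∀ {k v w R} → leg k ≡ v ∷ w ∷ R → v ≢ y →
                  ∃[ l ] (l ≢ k × Unique (col c x v ∷ cols c w R ++ cols c x (leg l)))
    skip-second {k} {v} {w} {R} eq v≢y with sub-leg Θ eq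
    ... | xv , vw ∷ wR , uR
      with fork-at c (Adj-irrefl G vw) (pairs c rc (Adj-irrefl G vw)) (inner Θ eq v≢y (here refl) v≢y) (Adj-sym G xv) vw x≢w
      where
      x≢w : x ≢ w
      x≢w refl = x∉leg k (∈leg Θ eq (there (here refl)))
    ... | [] , _ , ((_ ∷ [] , _) , _) , _ = ⊥-elim (x∉leg k (∈leg Θ eq (there (here refl))))
    ... | d ∷ K , _ , ((vx ∷ wK@(xd ∷ _) , uK) , cK) , _ with exit xd
    ... | l , hd with l Fin.≟ k
    ... | yes refl = ⊥-elim (unique-head∉ uK (there (here (≡.sym (∷-injectiveˡ (≡.trans (≡.sym (proj₂ hd)) eq))))))
    ... | no l≢k with follow-forth Θ l hd (wK , unique-tail uK) (λ w∈ → disjoint l≢k w∈ (∈leg Θ eq (there (here refl))))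
    ... | K₁ , e₁ , wK₁ = l , l≢k , finish (descend wK₁ (path-suffix (walk l) wK₁ uxK))
      where
      uxK : Unique (x ∷ leg l ++ K₁)
      uxK = subst (λ S → Unique (x ∷ S)) e₁ (unique-tail uK)
      x∉ : x ∉ leg l ++ K₁
      x∉ = unique-head∉ uxK
      back : ∀ {l′} → l′ ≢ k → w ≢ y → w ∈ rv x (leg l′) → w ≡ x
      back {l′} l′≢k w≢y w∈ with rv-leg l′ w∈
      ... | here e    = e
      ... | there w∈′ = ⊥-elim (w≢y (disjoint l′≢k w∈′ (∈leg Θ eq (there (here refl)))))
      descend : Walk G y K₁ w → Path G y K₁ w → ∃[ K₂ ] K₁ ≡ rv w R ++ K₂
      descend q pK₁ with w Fin.≟ y
      ... | yes w≡y rewrite loop-trivial wR (unique-tail uR) w≡y = K₁ , refl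
      descend [] pK₁ | no w≢y = ⊥-elim (w≢y refl)
      descend (yd′ ∷ _) pK₁ | no w≢y with exit′ yd′
      -- From `y` the path can use neither leg `l` again nor the third leg, which leads to `x` a
      -- second time.
      ... | l′ , hd′ with l′ Fin.≟ l | l′ Fin.≟ k
      ... | yes refl | _ = ⊥-elim (unique-++-disjoint (x ∷ leg l) uxK (rv-leg l (head∈ hd′)) (here refl))
      ... | no _ | yes refl
        with follow-leg (path-rv (wR , unique-tail uR)) (λ t∈ t≢w → inner Θ eq v≢y (there (rv-∈ wR t∈)) (λ { refl → unique-head∉ (proj₂ (path-rv (wR , unique-tail uR))) t∈ }))
               (head-++ (walk-end∈tail (walk-rv wR) (w≢y ∘ ≡.sym)) (head-back Θ eq v≢y hd′)) pK₁ (λ _ → refl)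
      ... | K₂ , e , _ = K₂ , e
      descend (yd′ ∷ _) pK₁ | no w≢y | l′ , hd′ | no _ | no l′≢k with follow-back Θ l′ hd′ pK₁ (back l′≢k w≢y)
      ... | K₂ , e , _ = ⊥-elim (x∉ (∈-++⁺ʳ (leg l) (subst (x ∈_) (≡.sym e) (∈-++⁺ˡ (x∈rv l′)))))
      finish : ∃[ K₂ ] K₁ ≡ rv w R ++ K₂ → Unique (col c x v ∷ cols c w R ++ cols c x (leg l))
      finish (K₂ , refl) = Unique-resp-↭ perm (cols-prefix c K₂ (vx ∷ walk l) (walk-rv wR)
          (subst (λ S → Unique (cols c v (x ∷ S))) e₁ cK))
        where
        open PermutationReasoning
        perm : cols c v (x ∷ leg l) ++ cols c y (rv w R) ↭ col c x v ∷ cols c w R ++ cols c x (leg l)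
        perm = begin
          col c v x ∷ cols c x (leg l) ++ cols c y (rv w R) ≡⟨ cong (_∷ (cols c x (leg l) ++ cols c y (rv w R))) (colSym c v x) ⟩
          col c x v ∷ cols c x (leg l) ++ cols c y (rv w R) ↭⟨ prep _ (++⁺ˡ (cols c x (leg l)) (cols-rv c wR)) ⟩
          col c x v ∷ cols c x (leg l) ++ cols c w R        ↭⟨ prep _ (++-comm (cols c x (leg l)) (cols c w R)) ⟩
          col c x v ∷ cols c w R ++ cols c x (leg l)        ∎

-- Distinct colours on the legs of a theta graph

module _ {A : Set} where

  ∈∷ʳ : ∀ {e x : A} xs → e ∈ xs ++ x ∷ [] → e ∈ xs ⊎ e ≡ x
  ∈∷ʳ xs e∈ with ∈-++⁻ xs e∈
  ... | inj₁ a          = inj₁ a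
  ... | inj₂ (here eq)  = inj₂ eq

  last∈ : ∀ {x : A} xs → x ∈ xs ++ x ∷ []
  last∈ xs = ∈-++⁺ʳ xs (here refl)

  -- The tails compare `m` with everything on the other leg except its first edge, and the initial
  -- parts supply that edge.
  mid-disjoint : ∀ {p q p′ q′ : A} m m′ → Unique ((m ++ q ∷ []) ++ (m′ ++ q′ ∷ [])) →
                 Unique ((p ∷ m) ++ (p′ ∷ m′)) → Disjoint m (p′ ∷ m′ ++ q′ ∷ [])
  mid-disjoint {p} {q} m m′ tails inits e∈ (here eq)  = unique-++-disjoint (p ∷ m) inits (there e∈) (here eq)
  mid-disjoint {p} {q} m m′ tails inits e∈ (there e∈′) = unique-++-disjoint (m ++ q ∷ []) tails (∈-++⁺ˡ e∈) e∈′

  -- Restores the colour `g` of the edge left out by `skip-second`: the tail and the initial part of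
  -- its own leg separate `g` from the rest of that leg.
  insert-second : ∀ {p g q : A} {m} ξ → Unique ((g ∷ m) ++ q ∷ []) → Unique (p ∷ g ∷ m) →
                  Unique (p ∷ (m ++ q ∷ []) ++ ξ) → g ∉ ξ → Unique ((p ∷ (g ∷ m) ++ q ∷ []) ++ ξ)
  insert-second {p} {g} {q} {m} ξ tail init u g∉ = Unique-resp-↭ (swap g p ↭-refl) (unique-∷ g∉′ u)
    where
    g∉′ : g ∉ p ∷ (m ++ q ∷ []) ++ ξ
    g∉′ (here refl) = unique-head∉ init (here refl)
    g∉′ (there g∈) with ∈-++⁻ (m ++ q ∷ []) g∈
    ... | inj₁ a = unique-head∉ tail a
    ... | inj₂ b = g∉ b

module _ {r : ℕ} where
  open DecMembership (_≟ᶠ_ {r}) using (_∈?_)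

  -- By mid-disjoint an inner colour of one long leg occurs on no other, so only end colours can repeat, and dropping
  -- the two end edges of β leaves a rainbow set.
  three-long : ∀ {a₁ a₂ b₁ b₂ c₁ c₂ g : Fin r} mA mB m →
    let α = a₁ ∷ mA ++ a₂ ∷ [] ; γ = c₁ ∷ (g ∷ m) ++ c₂ ∷ [] in
    Unique (c₁ ∷ (m ++ c₂ ∷ []) ++ α) →
    Unique ((g ∷ m ++ c₂ ∷ []) ++ (mA ++ a₂ ∷ [])) → Unique ((c₁ ∷ g ∷ m) ++ (a₁ ∷ mA)) →
    Unique ((mB ++ b₂ ∷ []) ++ (g ∷ m ++ c₂ ∷ [])) → Unique ((b₁ ∷ mB) ++ (c₁ ∷ g ∷ m)) →
    Unique ((mB ++ b₂ ∷ []) ++ (mA ++ a₂ ∷ [])) → Unique ((b₁ ∷ mB) ++ (a₁ ∷ mA)) →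
    Unique ((γ ++ α) ++ mB)
  three-long {a₁} {a₂} {b₁} {b₂} {c₁} {c₂} {g} mA mB m skip CAt CAi BCt BCi BAt BAi =
    unique-++ (insert-second _ (unique-++ˡ (g ∷ m ++ c₂ ∷ []) CAt) (unique-++ˡ (c₁ ∷ g ∷ m) CAi) skip
           (mid-disjoint (g ∷ m) mA CAt CAi (here refl)))
        (unique-++ˡ mB (unique-++ˡ (mB ++ b₂ ∷ []) BCt))
        λ e∈ e∈B → [ mid-disjoint mB (g ∷ m) BCt BCi e∈B , mid-disjoint mB mA BAt BAi e∈B ]′ (∈-++⁻ (c₁ ∷ (g ∷ m) ++ c₂ ∷ []) e∈)

  -- The edge e forms a leg of its own. If b₁ and b₂ both recur in γ then b₁ = c₂ and no cycle avoiding only one edge of γ,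
  -- or the first of β, can combine β with γ; hence e is a new colour and extends γ ++ mB.
  two-long : ∀ {e b₁ b₂ c₁ c₂ g : Fin r} mB m →
    let β = b₁ ∷ mB ++ b₂ ∷ [] ; γ = c₁ ∷ (g ∷ m) ++ c₂ ∷ [] in
    Unique (c₁ ∷ (m ++ c₂ ∷ []) ++ e ∷ []) ⊎ Unique (c₁ ∷ (m ++ c₂ ∷ []) ++ β) →
    Unique ((g ∷ m ++ c₂ ∷ []) ++ e ∷ []) ⊎ Unique ((g ∷ m ++ c₂ ∷ []) ++ β) →
    Unique ((mB ++ b₂ ∷ []) ++ e ∷ []) ⊎ Unique ((mB ++ b₂ ∷ []) ++ γ) →
    Unique ((mB ++ b₂ ∷ []) ++ (g ∷ m ++ c₂ ∷ [])) → Unique ((b₁ ∷ mB) ++ (c₁ ∷ g ∷ m)) →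
    ∃[ z ] Unique (z ∷ γ ++ mB)
  two-long {e} {b₁} {b₂} {c₁} {c₂} {g} mB m hg hh hb BCt BCi = conclude (b₁ ∈? γ) (b₂ ∈? γ)
    where
    β γ : List (Fin r)
    β = b₁ ∷ mB ++ b₂ ∷ []
    γ = c₁ ∷ (g ∷ m) ++ c₂ ∷ []
    tB! : Unique (mB ++ b₂ ∷ [])
    tB! = unique-++ˡ (mB ++ b₂ ∷ []) BCt
    skip! : Unique (c₁ ∷ m ++ c₂ ∷ [])
    skip! = [ unique-++ˡ (c₁ ∷ m ++ c₂ ∷ []) , unique-++ˡ (c₁ ∷ m ++ c₂ ∷ []) ]′ hg
    γ! : Unique γ
    γ! = subst Unique (++-identityʳ γ) (insert-second [] (unique-++ʳ (mB ++ b₂ ∷ []) BCt) (unique-++ʳ (b₁ ∷ mB) BCi)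
           (subst Unique (≡.sym (++-identityʳ _)) skip!) (λ ()))
    γmB! : Unique (γ ++ mB)
    γmB! = unique-++ γ! (unique-++ˡ mB tB!) (λ e∈ e∈B → mid-disjoint mB (g ∷ m) BCt BCi e∈B e∈)
    extend : ∀ {z} → z ∉ γ → z ∉ mB → ∃[ z ] Unique (z ∷ γ ++ mB)
    extend z∉γ z∉mB = _ , unique-∷ (λ z∈ → [ z∉γ , z∉mB ]′ (∈-++⁻ γ z∈)) γmB!
    conclude : Dec (b₁ ∈ γ) → Dec (b₂ ∈ γ) → ∃[ z ] Unique (z ∷ γ ++ mB)
    conclude (no b₁∉) _       = extend b₁∉ (unique-head∉ (unique-++ˡ (b₁ ∷ mB) BCi))
    conclude (yes _) (no b₂∉) = extend b₂∉ (λ b₂∈ → unique-++-disjoint mB tB! b₂∈ (here refl))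
    conclude (yes b₁∈) (yes b₂∈) = extend e∉γ e∉mB
      where
      b₁≡c₂ : b₁ ≡ c₂
      b₁≡c₂ with ∈∷ʳ (c₁ ∷ g ∷ m) b₁∈
      ... | inj₁ a  = ⊥-elim (unique-++-disjoint (b₁ ∷ mB) BCi (here refl) a)
      ... | inj₂ eq = eq
      only-e : ∀ {xs} → c₂ ∈ xs → Unique (xs ++ e ∷ []) ⊎ Unique (xs ++ β) → e ∉ xs
      only-e {xs} c₂∈ (inj₁ u) e∈ = unique-++-disjoint xs u e∈ (here refl)
      only-e {xs} c₂∈ (inj₂ u) e∈ = unique-++-disjoint xs u c₂∈ (here (≡.sym b₁≡c₂))
      e∉γ : e ∉ γ
      -- Of `γ`, the list in `hg` lacks only `g` and the one in `hh` only `c₁`, so together they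
      -- separate `e` from all of it.
      e∉γ (here eq)          = only-e (there (last∈ m)) hg (here eq)
      e∉γ (there e∈)         = only-e (last∈ (g ∷ m)) hh e∈
      e∉mB : e ∉ mB
      -- The way back cannot be `γ`, because `b₂` would occur twice.
      e∉mB e∈ = [ (λ u → unique-++-disjoint (mB ++ b₂ ∷ []) u (∈-++⁺ˡ e∈) (here refl))
                , (λ u → unique-++-disjoint (mB ++ b₂ ∷ []) u (last∈ mB) b₂∈) ]′ hb

module _ {n r} {G : Graph n} (c : Colouring G r) (rc : Rainbow2Connected c) where

  -- A leg with an inner vertex; `p` and `l` are those next to `x` and to `y`, and coincide when `L`
  -- is empty. The end colours are kept apart from `mid` because only they can recur on another long
  -- leg.
  record LongLeg {x y} (Θ : Theta G x y) (i : Fin 3) : Set where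
    constructor long
    open Theta Θ
    field
      {p l}  : Fin n
      L      : List (Fin n)
      leg≡   : leg i ≡ p ∷ L ++ y ∷ []
      inside : Walk G p L l
      final  : Adj G l y

    first last : Fin r
    first = col c x p
    last  = col c l y
    mid : List (Fin r)
    mid = cols c p L

    tail≡ : cols c p (L ++ y ∷ []) ≡ mid ++ last ∷ []
    tail≡ = cols-++ c (y ∷ []) inside

    cols≡ : cols c x (leg i) ≡ first ∷ mid ++ last ∷ []
    cols≡ = ≡.trans (cong (cols c x) leg≡) (cong (first ∷_) tail≡)

    length≡ : length (leg i) ≡ 2 + length mid
    length≡ = begin
      length (leg i)                      ≡⟨ cong length leg≡ ⟩
      suc (length (L ++ y ∷ []))          ≡⟨ cong suc (length-++ L) ⟩
      suc (length L + 1)                  ≡⟨ cong suc (+-comm (length L) 1) ⟩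
      2 + length L                        ≡⟨ cong (2 +_) (length-cols c p L) ⟨
      2 + length mid                      ∎
      where open ≡-Reasoning

    p≢y : p ≢ y
    p≢y p≡y = unique-head∉ (unique-tail (subst (λ S → Unique (x ∷ S)) leg≡ (proj₂ (path i))))
                  (subst (_∈ L ++ y ∷ []) (≡.sym p≡y) (last∈ L))

    xp : Adj G x p
    xp = proj₁ (sub-leg Θ leg≡)

    rv≡ : rv x (leg i) ≡ l ∷ rv x (p ∷ L)
    rv≡ = ≡.trans (cong (rv x) leg≡) (rv-++ (y ∷ []) (xp ∷ inside))

    l≢x : l ≢ x
    l≢x l≡x = x∉leg i (subst (x ∈_) (≡.sym leg≡) (∈-++⁺ˡ (subst (_∈ p ∷ L) l≡x (walk-end∈ inside))))

    inits : cols c l (rv x (p ∷ L)) ↭ first ∷ mid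
    inits = cols-rv c (xp ∷ inside)

  open LongLeg

  module _ {x y} (Θ : Theta G x y) where
    open Theta Θ

    short-or-long : ∀ i → leg i ≡ y ∷ [] ⊎ LongLeg Θ i
    short-or-long i = go (leg i) refl (walk i)
      where
      unsnoc : ∀ {u a A} → Walk G u (a ∷ A) y → ∃[ B ] ∃[ l ] (a ∷ A ≡ B ++ y ∷ [] × Walk G u B l × Adj G l y)
      unsnoc (e ∷ [])            = [] , _ , refl , [] , e
      unsnoc {a = a} (e ∷ w@(_ ∷ _)) with unsnoc w
      ... | B , l , eq , w′ , f = a ∷ B , l , cong (a ∷_) eq , e ∷ w′ , f
      go : ∀ T → leg i ≡ T → Walk G x T y → leg i ≡ y ∷ [] ⊎ LongLeg Θ i
      go []       eq []       = ⊥-elim (x≢y refl)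
      go (_ ∷ []) eq (_ ∷ []) = inj₁ eq
      go (p ∷ _ ∷ _) eq (e ∷ w) with unsnoc w
      ... | B , l , eq′ , w′ , f = inj₂ (long B (≡.trans eq (cong (p ∷_) eq′)) w′ f)

    cross-tails : ∀ {i j} (P : LongLeg Θ i) (Q : LongLeg Θ j) → i ≢ j →
                  Unique ((mid P ++ last P ∷ []) ++ (mid Q ++ last Q ∷ []))
    cross-tails P Q i≢j =
      subst Unique (cong₂ _++_ (tail≡ P) (tail≡ Q)) (cross c rc Θ i≢j (leg≡ P) (leg≡ Q) (p≢y P) (p≢y Q))

    -- `cross` omits the edges at `x`; in the flipped theta graph it omits the edges at `y` instead.
    cross-inits : ∀ {i j} (P : LongLeg Θ i) (Q : LongLeg Θ j) → i ≢ j →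
                  Unique ((first P ∷ mid P) ++ (first Q ∷ mid Q))
    cross-inits P Q i≢j =
      Unique-resp-↭ (++⁺ (inits P) (inits Q)) (cross c rc (flip Θ) i≢j (rv≡ P) (rv≡ Q) (l≢x P) (l≢x Q))

    tail-skip : ∀ {k} (R : LongLeg Θ k) → ∃[ l ] (l ≢ k × Unique ((mid R ++ last R ∷ []) ++ cols c x (leg l)))
    tail-skip R with skip-first c rc Θ (leg≡ R) (p≢y R)
    ... | l , l≢k , u = l , l≢k , subst (λ S → Unique (S ++ cols c x (leg l))) (tail≡ R) u

    size : Fin 3 → Fin 3 → Fin 3 → ℕ
    size i j k = length (leg i) + length (leg j) + length (leg k)

    -- Here `s` is the number of edges on the three legs, at least `n + 1`; giving up two of them
    -- leaves `n - 1` colours.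
    Rest : ℕ → Set
    Rest s = ∃[ ξ ] (Unique {A = Fin r} ξ × 2 + length ξ ≡ s)

    module _ {i j k} (i≢j : i ≢ j) (i≢k : i ≢ k) (j≢k : j ≢ k) (Q : LongLeg Θ j)
             {p w l L} (eq : leg k ≡ p ∷ w ∷ L ++ y ∷ []) (pw : Adj G p w) (ins : Walk G w L l) (fin : Adj G l y) where
      private
        R : LongLeg Θ k
        R = long (w ∷ L) eq (pw ∷ ins) fin
        m γ : List (Fin r)
        m = cols c w L
        γ = first R ∷ mid R ++ last R ∷ []
        lengthγ : length γ ≡ length (leg k)
        lengthγ = ≡.trans (cong length (≡.sym (cols≡ R))) (length-cols c x (leg k))

      rest-three-long : (P : LongLeg Θ i) → Unique (col c x p ∷ (m ++ last R ∷ []) ++ cols c x (leg i)) → Rest (size i j k)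
      rest-three-long P skip = _ ,
        three-long {a₂ = last P} (mid P) (mid Q) m
          (subst (λ S → Unique (col c x p ∷ (m ++ last R ∷ []) ++ S)) (cols≡ P) skip)
          (cross-tails R P (i≢k ∘ ≡.sym)) (cross-inits R P (i≢k ∘ ≡.sym))
          (cross-tails Q R j≢k) (cross-inits Q R j≢k)
          (cross-tails Q P (i≢j ∘ ≡.sym)) (cross-inits Q P (i≢j ∘ ≡.sym)) ,
        (begin
          2 + length ((γ ++ α) ++ mid Q)                  ≡⟨ cong (2 +_) (length-++ (γ ++ α)) ⟩
          2 + (length (γ ++ α) + length (mid Q))          ≡⟨ cong (λ s → 2 + (s + length (mid Q))) (length-++ γ) ⟩
          2 + (length γ + length α + length (mid Q))      ≡⟨ rearrange (length γ) (length α) (length (mid Q)) ⟩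
          length α + (2 + length (mid Q)) + length γ      ≡⟨ cong₂ _+_ (cong₂ _+_ lengthα (≡.sym (length≡ Q))) lengthγ ⟩
          size i j k                                      ∎)
        where
        open ≡-Reasoning
        α : List (Fin r)
        α = first P ∷ mid P ++ last P ∷ []
        lengthα : length α ≡ length (leg i)
        lengthα = ≡.trans (cong length (≡.sym (cols≡ P))) (length-cols c x (leg i))
        rearrange : ∀ a b d → 2 + (a + b + d) ≡ b + (2 + d) + a
        rearrange = solve 3 (λ a b d → con 2 :+ (a :+ b :+ d) := b :+ (con 2 :+ d) :+ a) refl
          where open +-*-Solver

      -- Each skip returns either by the edge `xy` or by the remaining long leg, and `at-k`, `at-j`
      -- pass this alternative on to `two-long`. The list obtained has `γ`, `mid Q` and one further
      -- colour, two fewer than the edges.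
      rest-two-long : leg i ≡ y ∷ [] → (∀ l → l ≡ i ⊎ l ≡ j ⊎ l ≡ k) →
                      ∃[ l ] (l ≢ k × Unique (col c x p ∷ (m ++ last R ∷ []) ++ cols c x (leg l))) → Rest (size i j k)
      rest-two-long short all skip = _ ,
        proj₂ (two-long {e = col c x y} {b₁ = first Q} (mid Q) m (at-k skip) (at-k (tail-skip R)) (at-j (tail-skip Q))
                 (cross-tails Q R j≢k) (cross-inits Q R j≢k)) ,
        (begin
          3 + length (γ ++ mid Q)                    ≡⟨ cong (3 +_) (length-++ γ) ⟩
          3 + (length γ + length (mid Q))            ≡⟨ cong (3 +_) (+-comm (length γ) (length (mid Q))) ⟩
          1 + (2 + length (mid Q)) + length γ        ≡⟨ cong₂ _+_ (cong₂ _+_ (cong length (≡.sym short)) (≡.sym (length≡ Q))) lengthγ ⟩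
          size i j k                                 ∎)
        where
        open ≡-Reasoning
        at-k : ∀ {xs} → ∃[ l ] (l ≢ k × Unique (xs ++ cols c x (leg l))) →
               Unique (xs ++ col c x y ∷ []) ⊎ Unique (xs ++ (first Q ∷ mid Q ++ last Q ∷ []))
        at-k {xs} (l , l≢k , u) with all l
        ... | inj₁ refl        = inj₁ (subst (λ S → Unique (xs ++ S)) (cong (cols c x) short) u)
        ... | inj₂ (inj₁ refl) = inj₂ (subst (λ S → Unique (xs ++ S)) (cols≡ Q) u)
        ... | inj₂ (inj₂ l≡k)  = ⊥-elim (l≢k l≡k)
        at-j : ∀ {xs} → ∃[ l ] (l ≢ j × Unique (xs ++ cols c x (leg l))) →
               Unique (xs ++ col c x y ∷ []) ⊎ Unique (xs ++ γ)
        at-j {xs} (l , l≢j , u) with all l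
        ... | inj₁ refl        = inj₁ (subst (λ S → Unique (xs ++ S)) (cong (cols c x) short) u)
        ... | inj₂ (inj₁ l≡j)  = ⊥-elim (l≢j l≡j)
        ... | inj₂ (inj₂ refl) = inj₂ (subst (λ S → Unique (xs ++ S)) (cols≡ R) u)

    -- Length 3 makes the second edge of leg `k` an inner one, so its colour can be restored after
    -- `skip-second`. If all legs are long, the leg by which the skip returns is kept whole and the
    -- other one gives up its end edges.
    rest : ∀ {i j k} → i ≢ j → i ≢ k → j ≢ k → (∀ l → l ≡ i ⊎ l ≡ j ⊎ l ≡ k) → 3 ≤ length (leg k) → Rest (size i j k)
    rest {i} {j} {k} i≢j i≢k j≢k all 3≤ with short-or-long k
    ... | inj₁ short with subst (3 ≤_) (cong length short) 3≤
    ...   | s≤s ()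
    rest {i} {j} {k} i≢j i≢k j≢k all 3≤ | inj₂ (long [] eq _ _) with subst (3 ≤_) (cong length eq) 3≤
    ...   | s≤s (s≤s ())
    rest {i} {j} {k} i≢j i≢k j≢k all 3≤ | inj₂ R@(long {p} {l} (w ∷ L) eq (pw ∷ ins) fin)
      with short-or-long i | short-or-long j | skip-second c rc Θ eq (p≢y R)
    ... | inj₁ si | inj₁ sj | _ = ⊥-elim (distinct i≢j (≡.trans si (≡.sym sj)))
    ... | inj₁ si | inj₂ Q  | l′ , l′≢k , u =
      rest-two-long i≢j i≢k j≢k Q eq pw ins fin si all (l′ , l′≢k , subst (λ S → Unique (col c x p ∷ S ++ _)) (cols-++ c (y ∷ []) ins) u)
    ... | inj₂ P  | inj₁ sj | l′ , l′≢k , u =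
      subst Rest (cong (_+ length (leg k)) (+-comm (length (leg j)) (length (leg i))))
        (rest-two-long (i≢j ∘ ≡.sym) j≢k i≢k P eq pw ins fin sj all′ (l′ , l′≢k , subst (λ S → Unique (col c x p ∷ S ++ _)) (cols-++ c (y ∷ []) ins) u))
      where
      all′ : ∀ l → l ≡ j ⊎ l ≡ i ⊎ l ≡ k
      all′ l with all l
      ... | inj₁ a        = inj₂ (inj₁ a)
      ... | inj₂ (inj₁ b) = inj₁ b
      ... | inj₂ (inj₂ d) = inj₂ (inj₂ d)
    ... | inj₂ P  | inj₂ Q  | l′ , l′≢k , u with all l′ | subst (λ S → Unique (col c x p ∷ S ++ cols c x (leg l′))) (cols-++ c (y ∷ []) ins) u
    ...   | inj₁ refl        | u′ = rest-three-long i≢j i≢k j≢k Q eq pw ins fin P u′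
    ...   | inj₂ (inj₁ refl) | u′ = subst Rest (cong (_+ length (leg k)) (+-comm (length (leg j)) (length (leg i))))
                                      (rest-three-long (i≢j ∘ ≡.sym) j≢k i≢k P eq pw ins fin Q u′)
    ...   | inj₂ (inj₂ l′≡k) | _ = ⊥-elim (l′≢k l′≡k)

    -- The legs together with `x` are closed under adjacency, hence contain all vertices. Their
    -- total length omits `x` and counts `y` three times, whence the surplus of one.
    legs-cover : suc n ≤ size 0F 1F 2F
    legs-cover with init 1F | init 2F
      where
      init : ∀ i → ∃[ M ] leg i ≡ M ++ y ∷ []
      init i with leg i | walk i
      ... | [] | [] = ⊥-elim (x≢y refl)
      ... | _ ∷ _ | w = walk-last w
    ... | M₁ , eq₁ | M₂ , eq₂ = begin
      suc n                                                       ≤⟨ s≤s (≤length-covering cover (∈cover ∘ all)) ⟩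
      suc (length cover)                                          ≡⟨ cong (2 +_) (≡.trans (length-++ (leg 0F)) (cong (length (leg 0F) +_) (length-++ M₁))) ⟩
      2 + (length (leg 0F) + (length M₁ + length M₂))             ≡⟨ rearrange (length (leg 0F)) (length M₁) (length M₂) ⟩
      length (leg 0F) + (length M₁ + 1) + (length M₂ + 1)         ≡⟨ cong₂ _+_ (cong (length (leg 0F) +_) (len M₁ eq₁)) (len M₂ eq₂) ⟩
      size 0F 1F 2F                                               ∎
      where
      open ≤-Reasoning
      rearrange : ∀ a b d → 2 + (a + (b + d)) ≡ a + (b + 1) + (d + 1)
      rearrange = solve 3 (λ a b d → con 2 :+ (a :+ (b :+ d)) := a :+ (b :+ con 1) :+ (d :+ con 1)) refl
        where open +-*-Solver
      len : ∀ {T} M → T ≡ M ++ y ∷ [] → length M + 1 ≡ length T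
      len M refl = ≡.sym (length-++ M)
      cover : List (Fin n)
      cover = x ∷ leg 0F ++ M₁ ++ M₂
      InΘ : Fin n → Set
      InΘ v = v ≡ x ⊎ ∃[ i ] v ∈ leg i
      closed : ∀ {s t} → InΘ s → Adj G s t → InΘ t
      closed (inj₁ refl) a with exit a
      ... | i , h = inj₂ (i , head∈ h)
      closed {s} (inj₂ (i , s∈)) a with s ≟ᶠ y
      closed (inj₂ (i , s∈)) a | yes refl with exit′ a
      ... | j , h with rv-leg j (head∈ h)
      ... | here eq  = inj₁ eq
      ... | there t∈ = inj₂ (j , t∈)
      closed (inj₂ (i , s∈)) a | no s≢y with thread-nbr (walk i) (proj₂ (path i)) s∈ s≢y (two (λ { refl → x∉leg i s∈ }) s≢y) a
      ... | inj₁ t∈        = inj₂ (i , t∈)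
      ... | inj₂ (t≡x , _) = inj₁ t≡x
      all : ∀ v → InΘ v
      all = covers c rc InΘ (inj₁ {B = ∃[ i ] x ∈ leg i} refl) closed
      ∈cover : ∀ {v} → InΘ v → v ∈ cover
      ∈cover (inj₁ refl) = here refl
      ∈cover (inj₂ (0F , v∈)) = there (∈-++⁺ˡ v∈)
      ∈cover (inj₂ (1F , v∈)) with ∈∷ʳ M₁ (subst (_ ∈_) eq₁ v∈)
      ... | inj₁ a    = there (∈-++⁺ʳ (leg 0F) (∈-++⁺ˡ a))
      ... | inj₂ refl = there (∈-++⁺ˡ (y∈leg 0F))
      ∈cover (inj₂ (Fin.suc 1F , v∈)) with ∈∷ʳ M₂ (subst (_ ∈_) eq₂ v∈)
      ... | inj₁ a    = there (∈-++⁺ʳ (leg 0F) (∈-++⁺ʳ M₁ a))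
      ... | inj₂ refl = there (∈-++⁺ˡ (y∈leg 0F))

    theta-colours : 6 ≤ n → n ≤ suc r
    theta-colours 6≤n = conclude pick
      where
      a b d : ℕ
      a = length (leg 0F)
      b = length (leg 1F)
      d = length (leg 2F)
      conclude : Rest (size 0F 1F 2F) → n ≤ suc r
      conclude (ξ , u , eq) = ≤-trans (≤-pred (subst (suc n ≤_) (≡.sym eq) legs-cover)) (s≤s (length-unique≤ u))
      pick : Rest (size 0F 1F 2F)
      pick with 3 ≤? a | 3 ≤? b | 3 ≤? d
      ... | yes p | _ | _ = subst Rest (≡.trans (+-comm (b + d) a) (≡.sym (+-assoc a b d)))
        (rest (λ ()) (λ ()) (λ ())
          (λ { 0F → inj₂ (inj₂ refl) ; 1F → inj₁ refl ; 2F → inj₂ (inj₁ refl) }) p)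
      ... | no _ | yes p | _ = subst Rest (≡.trans (+-assoc a d b) (≡.trans (cong (a +_) (+-comm d b)) (≡.sym (+-assoc a b d))))
        (rest (λ ()) (λ ()) (λ ())
          (λ { 0F → inj₁ refl ; 1F → inj₂ (inj₂ refl) ; 2F → inj₂ (inj₁ refl) }) p)
      ... | no _ | no _ | yes p =
        rest (λ ()) (λ ()) (λ ())
          (λ { 0F → inj₁ refl ; 1F → inj₂ (inj₁ refl) ; 2F → inj₂ (inj₂ refl) }) p
      -- Three legs of length at most 2 have at most 6 edges, but there are at least 7.
      ... | no p | no q | no s = ⊥-elim (<-irrefl refl (begin-strict
          6                 <⟨ s≤s 6≤n ⟩
          suc n             ≤⟨ legs-cover ⟩
          a + b + d         ≤⟨ +-mono-≤ (+-mono-≤ (≤-pred (≰⇒> p)) (≤-pred (≰⇒> q))) (≤-pred (≰⇒> s)) ⟩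
          6                 ∎))
        where open ≤-Reasoning

-- From two branch vertices to a theta graph

module _ {n} (G : Graph n) where

  Three : Fin n → Set
  Three x = ∀ {a b c d} → Adj G x a → Adj G x b → Adj G x c → Adj G x d → a ≢ b → a ≢ c → b ≢ c → d ≡ a ⊎ d ≡ b ⊎ d ≡ c

module _ {n} {G : Graph n} where

  third : ∀ {x} → Branch G x → ∀ a b → ∃[ d ] (Adj G x d × d ≢ a × d ≢ b)
  third (p , q , s , xp , xq , xs , p≢q , p≢s , q≢s) a b with p ≟ᶠ a | p ≟ᶠ b | q ≟ᶠ a | q ≟ᶠ b
  ... | no p≢a   | no p≢b   | _        | _        = p , xp , p≢a , p≢b
  ... | _        | _        | no q≢a   | no q≢b   = q , xq , q≢a , q≢b
  ... | yes refl | _        | yes refl | _        = ⊥-elim (p≢q refl)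
  ... | yes refl | _        | no _     | yes refl = s , xs , p≢s ∘ ≡.sym , q≢s ∘ ≡.sym
  ... | no _     | yes refl | yes refl | _        = s , xs , q≢s ∘ ≡.sym , p≢s ∘ ≡.sym
  ... | no _     | yes refl | no _     | yes refl = ⊥-elim (p≢q refl)

  -- Since `x` is not a cut vertex, a path from `d` to `y` avoids it and can be prefixed with the
  -- edge `xd`.
  third-path : ∀ {x y d} → TwoConnected G → x ≢ y → Adj G x d → ∃[ T ] Path G x (d ∷ T) y
  third-path {x} {y} {d} (_ , _ , cut) x≢y xd with d ≟ᶠ y
  ... | yes refl = [] , xd ∷ [] , ((x≢y ∷ []) ∷ [] ∷ [])
  ... | no d≢y with cut x d y d≢y (Adj-irrefl G (Adj-sym G xd)) (x≢y ∘ ≡.sym)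
  ... | M , (ch , u) , x∉M = M ++ y ∷ [] , xd ∷ chain⇒walk M ch , unique-∷ x∉ u
    where
    x∉ : x ∉ d ∷ M ++ y ∷ []
    x∉ (here refl) = Adj-irrefl G xd refl
    x∉ (there x∈) with ∈∷ʳ M x∈
    ... | inj₁ a = x∉M a
    ... | inj₂ b = x≢y b

module _ {n r} {G : Graph n} (c : Colouring G r) (rc : Rainbow2Connected c) where

  -- Two legs come from the rainbow pair for `x` and `y`. The third is any path leaving `x` by its
  -- remaining edge; the pair gives no information about it, and `threads-disjoint` makes up for
  -- that.
  build-theta : TwoConnected G → ∀ {x y} → x ≢ y → Branch G x → Three G x → Three G y →
                (∀ {w} → w ≢ x → w ≢ y → Two G w) → Theta G x y
  build-theta tc {x} {y} x≢y bx three-x three-y two with fork c x≢y (pairs c rc x≢y)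
  ... | a , b , a≢b , A , B , (PA@(xa ∷ _ , _) , _) , (PB@(xb ∷ _ , _) , _) , _ with third {G = G} bx a b
  ... | d , xd , d≢a , d≢b with third-path tc x≢y xd
  ... | D , PD = record
    { leg = leg ; path = path ; x≢y = x≢y ; two = two
    ; disjoint = λ {i} {j} i≢j → threads-disjoint refl refl (head-injective i j i≢j) (path i) (path j) two
    ; distinct = λ {i} {j} i≢j eq → head-injective i j i≢j (∷-injectiveˡ eq)
    ; exit = exit ; exit′ = exit′ }
    where
    hd : Fin 3 → Fin n
    hd 0F = a
    hd 1F = b
    hd 2F = d
    tl : Fin 3 → List (Fin n)
    tl 0F = A
    tl 1F = B
    tl 2F = D
    leg : Fin 3 → List (Fin n)
    leg i = hd i ∷ tl i
    path : ∀ i → Path G x (leg i) y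
    path 0F = PA
    path 1F = PB
    path 2F = PD
    head-injective : ∀ i j → i ≢ j → hd i ≢ hd j
    head-injective 0F 0F i≢j = ⊥-elim (i≢j refl)
    head-injective 0F 1F _   = a≢b
    head-injective 0F 2F _   = d≢a ∘ ≡.sym
    head-injective 1F 0F _   = a≢b ∘ ≡.sym
    head-injective 1F 1F i≢j = ⊥-elim (i≢j refl)
    head-injective 1F 2F _   = d≢b ∘ ≡.sym
    head-injective 2F 0F _   = d≢a
    head-injective 2F 1F _   = d≢b
    head-injective 2F 2F i≢j = ⊥-elim (i≢j refl)
    exit : ∀ {e} → Adj G x e → ∃[ i ] Head (leg i) e
    exit xe with three-x xa xb xd xe a≢b (d≢a ∘ ≡.sym) (d≢b ∘ ≡.sym)
    ... | inj₁ refl        = 0F , _ , refl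
    ... | inj₂ (inj₁ refl) = 1F , _ , refl
    ... | inj₂ (inj₂ refl) = 2F , _ , refl
    last : ∀ i → ∃[ l ] (Head (rv x (leg i)) l × Adj G y l)
    last i with rv x (leg i) | walk-rv (proj₁ (path i))
    ... | [] | [] = ⊥-elim (x≢y refl)
    ... | l ∷ T | e ∷ _ = l , (T , refl) , e
    only-edge : ∀ i → Head (rv x (leg i)) x → hd i ≡ y
    only-edge i h with hd i ≟ᶠ y | path i
    ... | yes eq | _ = eq
    ... | no hd≢y | (_ ∷ p , u) = ⊥-elim (unique-head∉ u (rv-∈ p (head∈ (head-++ (walk-end∈tail (walk-rv p) (hd≢y ∘ ≡.sym)) h))))
    -- A common last vertex would lie on two legs and so be `y`, which is not its own neighbour, or
    -- else be `x`, which makes both legs the edge `xy`.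
    last-injective : ∀ i j → i ≢ j → proj₁ (last i) ≢ proj₁ (last j)
    last-injective i j i≢j eq with last i | last j
    last-injective i j i≢j refl | l , hi , yl | .l , hj , _
      with rv-∈ (proj₁ (path i)) (head∈ hi) | rv-∈ (proj₁ (path j)) (head∈ hj)
    ... | there a | there b = Adj-irrefl G yl (≡.sym (threads-disjoint refl refl (head-injective i j i≢j) (path i) (path j) two a b))
    ... | here refl | _         = head-injective i j i≢j (≡.trans (only-edge i hi) (≡.sym (only-edge j hj)))
    ... | there _   | here refl = head-injective i j i≢j (≡.trans (only-edge i hi) (≡.sym (only-edge j hj)))
    exit′ : ∀ {e} → Adj G y e → ∃[ i ] Head (rv x (leg i)) e
    exit′ ye with three-y (proj₂ (proj₂ (last 0F))) (proj₂ (proj₂ (last 1F))) (proj₂ (proj₂ (last 2F))) ye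
                    (last-injective 0F 1F (λ ())) (last-injective 0F 2F (λ ())) (last-injective 1F 2F (λ ()))
    ... | inj₁ refl        = 0F , proj₁ (proj₂ (last 0F))
    ... | inj₂ (inj₁ refl) = 1F , proj₁ (proj₂ (last 1F))
    ... | inj₂ (inj₂ refl) = 2F , proj₁ (proj₂ (last 2F))

-- Degree sums and the lower bounds

Σ[_] : ∀ {A : Set} → List A → (A → ℕ) → ℕ
Σ[ xs ] f = sum (map f xs)

module _ {A : Set} where

  Σ-cong : ∀ (xs : List A) {f g} → (∀ x → f x ≡ g x) → Σ[ xs ] f ≡ Σ[ xs ] g
  Σ-cong []       eq = refl
  Σ-cong (x ∷ xs) eq = cong₂ _+_ (eq x) (Σ-cong xs eq)

  Σ-mono : ∀ (xs : List A) {f g} → (∀ {x} → x ∈ xs → f x ≤ g x) → Σ[ xs ] f ≤ Σ[ xs ] g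
  Σ-mono []       le = z≤n
  Σ-mono (x ∷ xs) le = +-mono-≤ (le (here refl)) (Σ-mono xs (le ∘ there))

  Σ-const : ∀ (xs : List A) k → Σ[ xs ] (λ _ → k) ≡ length xs * k
  Σ-const []       k = refl
  Σ-const (x ∷ xs) k = cong (k +_) (Σ-const xs k)

  Σ-+ : ∀ (xs : List A) f g → Σ[ xs ] (λ x → f x + g x) ≡ Σ[ xs ] f + Σ[ xs ] g
  Σ-+ []       f g = refl
  Σ-+ (x ∷ xs) f g = ≡.trans (cong (f x + g x +_) (Σ-+ xs f g)) (interchange (f x) (g x) _ _)
    where
    interchange : ∀ a b d e → a + b + (d + e) ≡ a + d + (b + e)
    interchange = solve 4 (λ a b d e → a :+ b :+ (d :+ e) := a :+ d :+ (b :+ e)) refl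
      where open +-*-Solver

  Σ-unique : ∀ (xs : List A) {ys} f → Unique xs → (∀ {x} → x ∈ xs → x ∈ ys) → Σ[ xs ] f ≤ Σ[ ys ] f
  Σ-unique []       f u sub = z≤n
  Σ-unique (x ∷ xs) f u sub with ∈-∃++ (sub (here refl))
  ... | ys , zs , refl = begin
    f x + Σ[ xs ] f           ≤⟨ +-monoʳ-≤ (f x) (Σ-unique xs f (unique-tail u) sub′) ⟩
    Σ[ x ∷ ys ++ zs ] f       ≡⟨ sum-↭ (map⁺ f (shift x ys zs)) ⟨
    Σ[ ys ++ x ∷ zs ] f       ∎
    where
    open ≤-Reasoning
    sub′ : ∀ {y} → y ∈ xs → y ∈ ys ++ zs
    sub′ y∈ with ∈-resp-↭ (shift x ys zs) (sub (there y∈))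
    ... | here refl = ⊥-elim (unique-head∉ u y∈)
    ... | there y∈′ = y∈′

Σ-swap : ∀ {A B : Set} (xs : List A) (ys : List B) (f : A → B → ℕ) →
         Σ[ xs ] (λ x → Σ[ ys ] (f x)) ≡ Σ[ ys ] (λ y → Σ[ xs ] (λ x → f x y))
Σ-swap []       ys f = ≡.sym (≡.trans (Σ-const ys 0) (*-zeroʳ (length ys)))
Σ-swap (x ∷ xs) ys f = ≡.trans (cong (Σ[ ys ] (f x) +_) (Σ-swap xs ys f)) (≡.sym (Σ-+ ys (f x) _))

ind : Bool → ℕ
ind b = if b then 1 else 0

module _ {n} (G : Graph n) where

  private V = allFin n

  deg : Fin n → ℕ
  deg i = Σ[ V ] (λ j → ind (adj G i j))

  up : Fin n → Fin n → ℕ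
  up i j = ind (adj G i j ∧ (toℕ i <ᵇ toℕ j))

  up+up : ∀ i j → up i j + up j i ≡ ind (adj G i j)
  up+up i j rewrite Graph.sym G j i with adj G i j in e | toℕ i <ᵇ toℕ j in p | toℕ j <ᵇ toℕ i in q
  ... | false | _     | _     = refl
  ... | true  | true  | false = refl
  ... | true  | false | true  = refl
  ... | true  | true  | true  = ⊥-elim (<-asym (<ᵇ⇒< (toℕ i) (toℕ j) (subst T (≡.sym p) tt)) (<ᵇ⇒< (toℕ j) (toℕ i) (subst T (≡.sym q) tt)))
  ... | true  | false | false with <-cmp (toℕ i) (toℕ j)
  ...   | tri< lt _ _ = ⊥-elim (subst T p (<⇒<ᵇ lt))
  ...   | tri> _ _ gt = ⊥-elim (subst T q (<⇒<ᵇ gt))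
  ...   | tri≈ _ eq _ with toℕ-injective eq
  ...     | refl = ⊥-elim (Adj-irrefl G e refl)

  handshake : Σ[ V ] deg ≡ edgeCount G + edgeCount G
  handshake = begin
    Σ[ V ] deg
      ≡⟨ Σ-cong V (λ i → ≡.trans (Σ-cong V (λ j → ≡.sym (up+up i j))) (Σ-+ V (up i) (λ j → up j i))) ⟩
    Σ[ V ] (λ i → Σ[ V ] (up i) + Σ[ V ] (λ j → up j i))
      ≡⟨ Σ-+ V (λ i → Σ[ V ] (up i)) _ ⟩
    edgeCount G + Σ[ V ] (λ i → Σ[ V ] (λ j → up j i))
      ≡⟨ cong (edgeCount G +_) (Σ-swap V V (λ i j → up j i)) ⟩
    edgeCount G + edgeCount G ∎
    where open ≡-Reasoning

  deg-≥ : ∀ {i} xs → Unique xs → (∀ {x} → x ∈ xs → Adj G i x) → length xs ≤ deg i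
  deg-≥ {i} xs u adjs = begin
    length xs                          ≡⟨ *-identityʳ (length xs) ⟨
    length xs * 1                      ≡⟨ Σ-const xs 1 ⟨
    Σ[ xs ] (λ _ → 1)                  ≤⟨ Σ-mono xs (λ x∈ → ≤-reflexive (≡.sym (cong ind (adjs x∈)))) ⟩
    Σ[ xs ] (λ j → ind (adj G i j))    ≤⟨ Σ-unique xs _ u (λ _ → ∈-allFin _) ⟩
    deg i                              ∎
    where open ≤-Reasoning

  branch-deg : ∀ {x} → Branch G x → 3 ≤ deg x
  branch-deg (a , b , d , xa , xb , xd , a≢b , a≢d , b≢d) =
    deg-≥ (a ∷ b ∷ d ∷ []) ((a≢b ∷ a≢d ∷ []) ∷ (b≢d ∷ []) ∷ [] ∷ [])
      (λ { (here refl) → xa ; (there (here refl)) → xb ; (there (there (here refl))) → xd })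

  -- By the handshake lemma the excesses of the degrees over 2 sum to `2m - 2n`, where `m` is the
  -- number of edges, so a few branch vertices in `xs` already bound `m` from below.
  excess : (∀ i → 2 ≤ deg i) → ∀ xs → Unique xs → n * 2 + Σ[ xs ] (λ i → deg i ∸ 2) ≤ edgeCount G + edgeCount G
  excess 2≤ xs u = begin
    n * 2 + Σ[ xs ] (λ i → deg i ∸ 2)           ≤⟨ +-monoʳ-≤ (n * 2) (Σ-unique xs _ u (λ _ → ∈-allFin _)) ⟩
    n * 2 + Σ[ V ] (λ i → deg i ∸ 2)            ≡⟨ cong (λ k → k * 2 + Σ[ V ] (λ i → deg i ∸ 2)) (length-tabulate {n = n} id) ⟨
    length V * 2 + Σ[ V ] (λ i → deg i ∸ 2)     ≡⟨ cong (_+ Σ[ V ] (λ i → deg i ∸ 2)) (Σ-const V 2) ⟨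
    Σ[ V ] (λ _ → 2) + Σ[ V ] (λ i → deg i ∸ 2) ≡⟨ Σ-+ V (λ _ → 2) (λ i → deg i ∸ 2) ⟨
    Σ[ V ] (λ i → 2 + (deg i ∸ 2))              ≡⟨ Σ-cong V (λ i → m+[n∸m]≡n (2≤ i)) ⟩
    Σ[ V ] deg                                  ≡⟨ handshake ⟩
    edgeCount G + edgeCount G                   ∎
    where open ≤-Reasoning

  branch? : ∀ x → Dec (Branch G x)
  branch? x = any? λ a → any? λ b → any? λ d →
    (adj G x a Bool.≟ true) ×-dec (adj G x b Bool.≟ true) ×-dec (adj G x d Bool.≟ true) ×-dec
    ¬? (a ≟ᶠ b) ×-dec ¬? (a ≟ᶠ d) ×-dec ¬? (b ≟ᶠ d)

  ¬branch⇒two : ∀ {w} → ¬ Branch G w → Two G w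
  ¬branch⇒two ¬b {a} {b} {d} wa wb wd a≢b a≢d with b ≟ᶠ d
  ... | yes eq = eq
  ... | no b≢d = ⊥-elim (¬b (a , b , d , wa , wb , wd , a≢b , a≢d , b≢d))

-- Parity: twice a number is even, so an odd surplus `2k + 1` rounds up to `2k + 2`. Excess 1 thus
-- forces `n + 1` edges and excess 3 forces `n + 2`.
half-≤ : ∀ {n m} k → n * 2 + suc (k + k) ≤ m + m → n + suc k ≤ m
half-≤ {n} {m} k le with n + suc k ≤? m
... | yes p = p
... | no p = ⊥-elim (<-irrefl refl (begin-strict
  m + m                       ≤⟨ +-mono-≤ m≤ m≤ ⟩
  n + k + (n + k)             ≡⟨ rearrange n k ⟩
  n * 2 + (k + k)             <⟨ +-monoʳ-< (n * 2) (n<1+n (k + k)) ⟩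
  n * 2 + suc (k + k)         ≤⟨ le ⟩
  m + m                       ∎))
  where
  open ≤-Reasoning
  m≤ : m ≤ n + k
  m≤ = ≤-pred (subst (suc m ≤_) (+-suc n k) (≰⇒> p))
  rearrange : ∀ n k → n + k + (n + k) ≡ n * 2 + (k + k)
  rearrange = solve 2 (λ n k → n :+ k :+ (n :+ k) := n :* con 2 :+ (k :+ k)) refl
    where open +-*-Solver

point : ∀ {n} → 3 ≤ n → Fin n
point (s≤s _) = 0F

another : ∀ {n} → 3 ≤ n → (u : Fin n) → ∃[ v ] u ≢ v
another (s≤s (s≤s _)) Fin.zero    = 1F , λ ()
another (s≤s (s≤s _)) (Fin.suc u) = 0F , λ ()

module _ {n r} (G : Graph n) (tc : TwoConnected G) (c : Colouring G r) (rc : Rainbow2Connected c) where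

  2≤deg : ∀ i → 2 ≤ deg G i
  2≤deg i with two-neighbours c rc (proj₂ (another (proj₁ tc) i))
  ... | a , b , a≢b , ia , ib = deg-≥ G (a ∷ b ∷ []) ((a≢b ∷ []) ∷ [] ∷ []) (λ { (here refl) → ia ; (there (here refl)) → ib })

  excess-≤ : ∀ k xs → Unique xs → suc (k + k) ≤ Σ[ xs ] (λ i → deg G i ∸ 2) → n + suc k ≤ edgeCount G
  excess-≤ k xs u le = half-≤ k (≤-trans (+-monoʳ-≤ (n * 2) le) (excess G 2≤deg xs u))

  all-two-colours : (∀ w → Two G w) → n ≤ r
  all-two-colours = cycle-colours c rc (proj₂ (another (proj₁ tc) (point (proj₁ tc))))

  few-colours⇒edges+1 : r < n → n + 1 ≤ edgeCount G
  few-colours⇒edges+1 r<n with any? (branch? G)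
  ... | yes (x , bx) = excess-≤ 0 (x ∷ []) ([] ∷ []) (≤-trans (∸-monoˡ-≤ 2 (branch-deg G bx)) (m≤m+n _ 0))
  ... | no ¬b = ⊥-elim (<⇒≱ r<n (all-two-colours (λ w → ¬branch⇒two G (λ bw → ¬b (w , bw)))))

  fewer-colours⇒edges+2 : 6 ≤ n → suc r < n → n + 2 ≤ edgeCount G
  fewer-colours⇒edges+2 6≤n r<n with n + 2 ≤? edgeCount G
  ... | yes p = p
  ... | no few with any? (branch? G)
  ... | no ¬b = ⊥-elim (<⇒≱ (<-trans (n<1+n r) r<n) (all-two-colours (λ w → ¬branch⇒two G (λ bw → ¬b (w , bw)))))
  ... | yes (x , bx) with any? (λ y → ¬? (y ≟ᶠ x) ×-dec branch? G y)
  ... | no ¬y = ⊥-elim (second-branch c rc tc bx (λ {w} w≢x → ¬branch⇒two G (λ bw → ¬y (w , w≢x , bw))))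
  ... | yes (y , y≢x , by) = ⊥-elim (<⇒≱ r<n (theta-colours c rc Θ 6≤n))
    where
    3≤ : ∀ {z} → Branch G z → 1 ≤ deg G z ∸ 2
    3≤ bz = ∸-monoˡ-≤ 2 (branch-deg G bz)
    -- Below `n + 2` edges the excess is at most 2. A third branch vertex would make it 3, and so
    -- would a fourth neighbour of `x` or `y`.
    two : ∀ {w} → w ≢ x → w ≢ y → Two G w
    two {w} w≢x w≢y = ¬branch⇒two G λ bw → few (excess-≤ 1 (w ∷ x ∷ y ∷ [])
      ((w≢x ∷ w≢y ∷ []) ∷ ((y≢x ∘ ≡.sym) ∷ []) ∷ [] ∷ [])
      (+-mono-≤ (3≤ bw) (+-mono-≤ (3≤ bx) (+-mono-≤ (3≤ by) z≤n))))
    three : ∀ {z z′} → z ≢ z′ → Branch G z′ → Three G z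
    three {z} {z′} z≢z′ bz′ {a} {b} {e} {d} za zb ze zd a≢b a≢e b≢e with d ≟ᶠ a | d ≟ᶠ b | d ≟ᶠ e
    ... | yes p | _ | _ = inj₁ p
    ... | no _ | yes p | _ = inj₂ (inj₁ p)
    ... | no _ | no _ | yes p = inj₂ (inj₂ p)
    ... | no d≢a | no d≢b | no d≢e = ⊥-elim (few (excess-≤ 1 (z ∷ z′ ∷ []) ((z≢z′ ∷ []) ∷ [] ∷ [])
      (+-mono-≤ (∸-monoˡ-≤ 2 (deg-≥ G (d ∷ a ∷ b ∷ e ∷ [])
                   ((d≢a ∷ d≢b ∷ d≢e ∷ []) ∷ (a≢b ∷ a≢e ∷ []) ∷ (b≢e ∷ []) ∷ [] ∷ [])
                   (λ { (here refl) → zd ; (there (here refl)) → za ; (there (there (here refl))) → zb ; (there (there (there (here refl)))) → ze })))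
                (+-mono-≤ (3≤ bz′) z≤n))))
    Θ : Theta G x y
    Θ = build-theta c rc tc (y≢x ∘ ≡.sym) bx (three (y≢x ∘ ≡.sym) by) (three y≢x bx) two

-- The extremal graphs

module _ {n : ℕ} {G : Graph n} where

  walk-at : ∀ {u L v w} → Walk G u L v → w ∈ u ∷ L → ∃[ L₁ ] ∃[ L₂ ] (L ≡ L₁ ++ L₂ × Walk G u L₁ w × Walk G w L₂ v)
  walk-at p (here refl) = [] , _ , refl , [] , p
  walk-at (_∷_ {w = t} e p) (there w∈) with walk-at p w∈
  ... | L₁ , L₂ , refl , p₁ , p₂ = t ∷ L₁ , L₂ , refl , e ∷ p₁ , p₂

module _ {n r : ℕ} {G : Graph n} (c : Colouring G r) where

  pair-sym : ∀ {u v} → Pair c u v → Pair c v u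
  pair-sym {u} {v} (L , M , P@((p , uL) , _) , Q@((q , _) , _) , L≢M , meet) =
    rv u L , rv u M , rpath-rv c P , rpath-rv c Q ,
    (λ eq → L≢M (≡.trans (≡.sym (rv-rv p)) (≡.trans (cong (rv v) eq) (rv-rv q)))) ,
    λ w∈ w∈′ → at-u w∈ (rv-∈ p w∈) (rv-∈ q w∈′)
    where
    at-u : ∀ {w} → w ∈ rv u L → w ∈ u ∷ L → w ∈ u ∷ M → w ≡ u
    at-u _  (here eq)  _         = eq
    at-u _  (there _)  (here eq) = eq
    at-u w∈ (there a)  (there b) with meet a b
    ... | refl = ⊥-elim (unique-head∉ (proj₂ (path-rv (p , uL))) w∈)

  pairs⇒rainbow2 : (∀ {u v} → u ≢ v → Pair c u v) → Rainbow2Connected c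
  pairs⇒rainbow2 pr u v u≢v = pair⇒mids c u≢v (pr u≢v)

  -- Of two internally disjoint paths, at least one avoids a given vertex `w`.
  rainbow2⇒2-connected : 3 ≤ n → Rainbow2Connected c → TwoConnected G
  rainbow2⇒2-connected 3≤n rc = 3≤n , connected , avoiding
    where
    open DecMembership (_≟ᶠ_ {n}) using (_∈?_)
    connected : ∀ u v → u ≢ v → ∃[ mid ] IsPath G u mid v
    connected u v u≢v with rc u v u≢v
    ... | m , _ , (p , _) , _ = m , p
    avoiding : ∀ w u v → u ≢ v → u ≢ w → v ≢ w → ∃[ mid ] (IsPath G u mid v × w ∉ mid)
    avoiding w u v u≢v _ _ with rc u v u≢v
    ... | m , m′ , (p , _) , (q , _) , _ , dis with w ∈? m
    ... | no w∉  = m , p , w∉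
    ... | yes w∈ = m′ , q , dis w w∈

  -- The cycle is given as a path with a chord because a vertex `u` then splits the colours into
  -- those before and after it, and each edge of a hat has to avoid only one of the two parts.
  module HattedCycle {a b L} (pL : Walk G a L b) (uL : Unique (a ∷ L)) (cL : Unique (cols c a L))
              (ab : Adj G a b) (χ∉ : col c a b ∉ cols c a L) where

    a≢b : a ≢ b
    a≢b = Adj-irrefl G ab

    -- One arc is `L₂`; the other runs back to `a`, over the chord and back from `b`. That `u`
    -- precedes `v` costs nothing, by `pair-sym`.
    ring-pair : ∀ {u v} L₁ L₂ L₃ → L ≡ L₁ ++ L₂ ++ L₃ → Walk G a L₁ u → Walk G u L₂ v → Walk G v L₃ b → u ≢ v → Pair c u v
    ring-pair {u} {v} L₁ L₂ L₃ refl p₁ p₂ p₃ u≢v =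
      L₂ , M , ((p₂ , u∷L₂!) , unique-++ˡ (cols c u L₂) c₂₃!) , ((pM , uM) , cM) , L₂≢M , meet
      where
      M = rv a L₁ ++ b ∷ rv v L₃
      pM : Walk G u M v
      pM = walk-rv p₁ ⊕ (ab ∷ walk-rv p₃)
      u₂₃! : Unique (u ∷ L₂ ++ L₃)
      u₂₃! = unique-∷ (unique-++-disjoint (a ∷ L₁) uL (walk-end∈ p₁)) (unique-++ʳ (a ∷ L₁) uL)
      u∷L₂! : Unique (u ∷ L₂)
      u∷L₂! = unique-++ˡ (u ∷ L₂) u₂₃!
      v₃! : Unique (v ∷ L₃)
      v₃! = unique-∷ (unique-++-disjoint (u ∷ L₂) u₂₃! (walk-end∈ p₂)) (unique-++ʳ (u ∷ L₂) u₂₃!)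
      v∈L₂ : v ∈ L₂
      v∈L₂ = walk-end∈tail p₂ u≢v
      in₂₃ : ∀ {w} → w ∈ v ∷ L₃ → w ∈ L₂ ++ L₃
      in₂₃ (here refl) = ∈-++⁺ˡ v∈L₂
      in₂₃ (there w∈)  = ∈-++⁺ʳ L₂ w∈
      uM : Unique (u ∷ M)
      uM = Unique-resp-↭ (↭-sym (++⁺ (rv-↭ p₁) (rv-↭ p₃)))
             (unique-++ (unique-++ˡ (a ∷ L₁) uL) v₃! (λ w∈ w∈′ → unique-++-disjoint (a ∷ L₁) uL w∈ (in₂₃ w∈′)))
      cols≡ : cols c a (L₁ ++ L₂ ++ L₃) ≡ cols c a L₁ ++ cols c u L₂ ++ cols c v L₃
      cols≡ = ≡.trans (cols-++ c (L₂ ++ L₃) p₁) (cong (cols c a L₁ ++_) (cols-++ c L₃ p₂))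
      c! : Unique (cols c a L₁ ++ cols c u L₂ ++ cols c v L₃)
      c! = subst Unique cols≡ cL
      χ∉′ : col c a b ∉ cols c a L₁ ++ cols c u L₂ ++ cols c v L₃
      χ∉′ = χ∉ ∘ subst (_ ∈_) (≡.sym cols≡)
      c₂₃! : Unique (cols c u L₂ ++ cols c v L₃)
      c₂₃! = unique-++ʳ (cols c a L₁) c!
      colsM : cols c u M ↭ cols c a L₁ ++ col c a b ∷ cols c v L₃
      colsM = subst (_↭ _) (≡.sym (cols-++ c (b ∷ rv v L₃) (walk-rv p₁))) (++⁺ (cols-rv c p₁) (prep (col c a b) (cols-rv c p₃)))
      cM : Unique (cols c u M)
      cM = Unique-resp-↭ (↭-sym (↭-trans colsM (shift (col c a b) (cols c a L₁) (cols c v L₃))))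
             (unique-∷ (λ χ∈ → χ∉′ (sub χ∈)) (unique-++ (unique-++ˡ (cols c a L₁) c!) (unique-++ʳ (cols c u L₂) c₂₃!)
               (λ w∈ w∈′ → unique-++-disjoint (cols c a L₁) c! w∈ (∈-++⁺ʳ (cols c u L₂) w∈′))))
        where
        sub : ∀ {w} → w ∈ cols c a L₁ ++ cols c v L₃ → w ∈ cols c a L₁ ++ cols c u L₂ ++ cols c v L₃
        sub w∈ with ∈-++⁻ (cols c a L₁) w∈
        ... | inj₁ x = ∈-++⁺ˡ x
        ... | inj₂ y = ∈-++⁺ʳ (cols c a L₁) (∈-++⁺ʳ (cols c u L₂) y)
      -- The arcs differ because the colour of the chord occurs on `M` only.
      L₂≢M : L₂ ≢ M
      L₂≢M eq = χ∉′ (∈-++⁺ʳ (cols c a L₁) (∈-++⁺ˡ (subst (λ S → col c a b ∈ cols c u S) (≡.sym eq)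
                  (∈-resp-↭ (↭-sym colsM) (∈-++⁺ʳ (cols c a L₁) (here refl))))))
      meet : ∀ {w} → w ∈ L₂ → w ∈ M → w ≡ v
      meet w∈ w∈M with ∈-++⁻ (rv a L₁) w∈M
      ... | inj₁ x = ⊥-elim (unique-++-disjoint (a ∷ L₁) uL (rv-∈ p₁ x) (∈-++⁺ˡ w∈))
      ... | inj₂ y with ∈-resp-↭ (rv-↭ p₃) y
      ...   | here eq = eq
      ...   | there z = ⊥-elim (unique-++-disjoint L₂ (unique-tail u₂₃!) w∈ z)

    on-ring : ∀ {u v} → u ∈ a ∷ L → v ∈ a ∷ L → u ≢ v → Pair c u v
    on-ring u∈ v∈ u≢v with walk-at pL u∈
    ... | L₁ , L₂ , refl , p₁ , p₂ with ∈-++⁻ (a ∷ L₁) v∈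
    ... | inj₂ v∈₂ with walk-at p₂ (there v∈₂)
    ...   | L₃ , L₄ , refl , p₃ , p₄ = ring-pair L₁ L₃ L₄ refl p₁ p₃ p₄ u≢v
    on-ring u∈ v∈ u≢v | L₁ , L₂ , refl , p₁ , p₂ | inj₁ v∈₁ with walk-at p₁ v∈₁
    ...   | L₃ , L₄ , refl , p₃ , p₄ = pair-sym (ring-pair L₃ L₄ L₂ (++-assoc L₃ L₄ L₂) p₃ p₄ p₂ (u≢v ∘ ≡.sym))

    -- For `u` inside the path, the two paths go from `z` over `a` forwards and over `b` backwards.
    -- For `u` equal to `a` (`endᵇ`) or `b` (`endᵃ`) one path is an edge, and the other runs over
    -- all of `L` or, if the colours forbid this, over the chord.
    record Hat (z : Fin n) : Set where
      field
        z∉   : z ∉ a ∷ L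
        za   : Adj G z a
        zb   : Adj G z b
        fromᵃ : ∀ {L₁ L₂ u} → L ≡ L₁ ++ L₂ → Walk G a L₁ u → Walk G u L₂ b → u ≢ b → col c z a ∉ cols c a L₁
        fromᵇ : ∀ {L₁ L₂ u} → L ≡ L₁ ++ L₂ → Walk G a L₁ u → Walk G u L₂ b → u ≢ a → col c z b ∉ cols c u L₂
        endᵃ : col c z a ∉ cols c a L ⊎ col c z a ≢ col c a b
        endᵇ : col c z b ∉ cols c a L ⊎ col c z b ≢ col c a b

    module _ {z} (H : Hat z) where
      open Hat H

      hat-split : ∀ {L₁ L₂ u} → L ≡ L₁ ++ L₂ → Walk G a L₁ u → Walk G u L₂ b →
                  col c z a ∉ cols c a L₁ → col c z b ∉ cols c u L₂ → Pair c z u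
      hat-split {L₁} {L₂} {u} refl p₁ p₂ α∉ β∉ =
        a ∷ L₁ , b ∷ rv u L₂ ,
        ((za ∷ p₁ , unique-∷ (z∉ ∘ ∈-++⁺ˡ) (unique-++ˡ (a ∷ L₁) uL)) , unique-∷ α∉ (unique-++ˡ (cols c a L₁) c!)) ,
        ((zb ∷ walk-rv p₂ , Unique-resp-↭ (prep z (↭-sym (rv-↭ p₂))) (unique-∷ z∉₂ u₂!)) ,
          Unique-resp-↭ (prep _ (↭-sym (cols-rv c p₂))) (unique-∷ β∉ (unique-++ʳ (cols c a L₁) c!))) ,
        (a≢b ∘ ∷-injectiveˡ) , meet
        where
        c! : Unique (cols c a L₁ ++ cols c u L₂)
        c! = subst Unique (cols-++ c L₂ p₁) cL
        u₂! : Unique (u ∷ L₂)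
        u₂! = unique-∷ (unique-++-disjoint (a ∷ L₁) uL (walk-end∈ p₁)) (unique-++ʳ (a ∷ L₁) uL)
        z∉₂ : z ∉ u ∷ L₂
        z∉₂ (here refl) = z∉ (∈-++⁺ˡ (walk-end∈ p₁))
        z∉₂ (there z∈)  = z∉ (∈-++⁺ʳ (a ∷ L₁) z∈)
        meet : ∀ {w} → w ∈ a ∷ L₁ → w ∈ b ∷ rv u L₂ → w ≡ u
        meet w∈ w∈′ with ∈-resp-↭ (rv-↭ p₂) w∈′
        ... | here eq = eq
        ... | there x = ⊥-elim (unique-++-disjoint (a ∷ L₁) uL w∈ x)

      hat-triangle : ∀ {s t} → s ≢ t → z ≢ s → z ≢ t → Adj G z s → Adj G z t → Adj G s t → col c z s ≢ col c s t → Pair c z t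
      hat-triangle {s} {t} s≢t z≢s z≢t zs zt st ne =
        t ∷ [] , s ∷ t ∷ [] ,
        ((zt ∷ [] , (z≢t ∷ []) ∷ [] ∷ []) , [] ∷ []) ,
        ((zs ∷ st ∷ [] , (z≢s ∷ z≢t ∷ []) ∷ (s≢t ∷ []) ∷ [] ∷ []) , (ne ∷ []) ∷ [] ∷ []) ,
        (λ eq → s≢t (≡.sym (∷-injectiveˡ eq))) , λ { (here eq) _ → eq }

      z≢a : z ≢ a
      z≢a refl = z∉ (here refl)

      z≢b : z ≢ b
      z≢b refl = z∉ (walk-end∈ pL)

      hat-ring : ∀ {u} → u ∈ a ∷ L → Pair c z u
      hat-ring {u} u∈ with u ≟ᶠ a | u ≟ᶠ b
      ... | yes refl | _ = [ (λ β∉ → hat-split refl [] pL (λ ()) β∉)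
                           , (λ ne → hat-triangle (a≢b ∘ ≡.sym) z≢b z≢a zb za (Adj-sym G ab) (λ eq → ne (≡.trans eq (colSym c b a)))) ]′ endᵇ
      ... | no _ | yes refl = [ (λ α∉ → hat-split (≡.sym (++-identityʳ L)) pL [] α∉ (λ ()))
                              , (λ ne → hat-triangle a≢b z≢a z≢b za zb ab ne) ]′ endᵃ
      ... | no u≢a | no u≢b with walk-at pL u∈
      ... | L₁ , L₂ , eq , p₁ , p₂ = hat-split eq p₁ p₂ (fromᵃ eq p₁ p₂ u≢b) (fromᵇ eq p₁ p₂ u≢a)

    hat-hat : ∀ {z z′} → Hat z → Hat z′ → z ≢ z′ → col c z a ≢ col c z′ a → col c z b ≢ col c z′ b → Pair c z z′
    hat-hat {z} {z′} H H′ z≢z′ neᵃ neᵇ =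
      a ∷ z′ ∷ [] , b ∷ z′ ∷ [] , over (Hat.za H) (Hat.za H′) (z≢a H) (z≢a H′) neᵃ , over (Hat.zb H) (Hat.zb H′) (z≢b H) (z≢b H′) neᵇ ,
      (a≢b ∘ ∷-injectiveˡ) ,
      λ { (here refl) (here eq) → ⊥-elim (a≢b eq) ; (here refl) (there (here eq)) → eq ; (there (here eq)) _ → eq }
      where
      over : ∀ {s} → Adj G z s → Adj G z′ s → z ≢ s → z′ ≢ s → col c z s ≢ col c z′ s → RPath c z (s ∷ z′ ∷ []) z′
      over {s} zs z′s z≢s z′≢s ne =
        (zs ∷ Adj-sym G z′s ∷ [] , (z≢s ∷ z≢z′ ∷ []) ∷ ((z′≢s ∘ ≡.sym) ∷ []) ∷ [] ∷ []) ,
        ((λ eq → ne (≡.trans eq (colSym c s z′))) ∷ []) ∷ [] ∷ []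

    ring-pairs : (∀ v → v ∈ a ∷ L ⊎ Hat v) →
                 (∀ {z z′} → Hat z → Hat z′ → z ≢ z′ → col c z a ≢ col c z′ a × col c z b ≢ col c z′ b) →
                 ∀ {u v} → u ≢ v → Pair c u v
    ring-pairs all hats {u} {v} u≢v with all u | all v
    ... | inj₁ u∈ | inj₁ v∈ = on-ring u∈ v∈ u≢v
    ... | inj₁ u∈ | inj₂ Hv = pair-sym (hat-ring Hv u∈)
    ... | inj₂ Hu | inj₁ v∈ = hat-ring Hu v∈
    ... | inj₂ Hu | inj₂ Hv = hat-hat Hu Hv u≢v (proj₁ (hats Hu Hv u≢v)) (proj₂ (hats Hu Hv u≢v))

-- Upper bounds on edge counts

Σ-cartesian : ∀ {A B : Set} (xs : List A) (ys : List B) (f : A → B → ℕ) →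
              Σ[ cartesianProduct xs ys ] (λ p → f (proj₁ p) (proj₂ p)) ≡ Σ[ xs ] (λ x → Σ[ ys ] (f x))
Σ-cartesian []       ys f = refl
Σ-cartesian (x ∷ xs) ys f = begin
  sum (map g (map (x ,_) ys ++ cartesianProduct xs ys))           ≡⟨ cong sum (map-++ g (map (x ,_) ys) _) ⟩
  sum (map g (map (x ,_) ys) ++ map g (cartesianProduct xs ys))   ≡⟨ sum-++ (map g (map (x ,_) ys)) _ ⟩
  sum (map g (map (x ,_) ys)) + Σ[ cartesianProduct xs ys ] g     ≡⟨ cong₂ _+_ (cong sum (≡.sym (map-∘ ys))) (Σ-cartesian xs ys f) ⟩
  Σ[ ys ] (f x) + Σ[ xs ] (λ x → Σ[ ys ] (f x))                   ∎
  where
  open ≡-Reasoning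
  g = λ p → f (proj₁ p) (proj₂ p)

Σ-ind≤ : ∀ {A : Set} (xs : List A) {ys} (p : A → Bool) → Unique xs → (∀ {x} → x ∈ xs → p x ≡ true → x ∈ ys) →
         Σ[ xs ] (λ x → ind (p x)) ≤ length ys
Σ-ind≤ []       p u sub = z≤n
Σ-ind≤ (x ∷ xs) p u sub with p x in eq
... | false = Σ-ind≤ xs p (unique-tail u) (sub ∘ there)
... | true with ∈-∃++ (sub (here refl) eq)
...   | ys , zs , refl = ≤-trans (s≤s (Σ-ind≤ xs {ys ++ zs} p (unique-tail u) sub′)) (≤-reflexive (≡.sym (↭-length (shift x ys zs))))
  where
  sub′ : ∀ {y} → y ∈ xs → p y ≡ true → y ∈ ys ++ zs
  sub′ y∈ py with ∈-resp-↭ (shift x ys zs) (sub (there y∈) py)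
  ... | here refl = ⊥-elim (unique-head∉ u y∈)
  ... | there y∈′ = y∈′

-- An upper bound suffices for the constructed graphs: the lower bound applies to them as well and
-- makes it an equality.
edgeCount-≤ : ∀ {n} (G : Graph n) (E : List (Fin n × Fin n)) →
              (∀ {i j} → Adj G i j → toℕ i < toℕ j → (i , j) ∈ E) → edgeCount G ≤ length E
edgeCount-≤ {n} G E sub = begin
  edgeCount G                                              ≡⟨ Σ-cartesian (allFin n) (allFin n) (up G) ⟨
  Σ[ cartesianProduct (allFin n) (allFin n) ] (λ p → up G (proj₁ p) (proj₂ p))
    ≤⟨ Σ-ind≤ _ (λ p → adj G (proj₁ p) (proj₂ p) ∧ (toℕ (proj₁ p) <ᵇ toℕ (proj₂ p)))
         (Unique.cartesianProduct⁺ (Unique.allFin⁺ n) (Unique.allFin⁺ n)) (λ {p} _ → in-E (proj₁ p) (proj₂ p)) ⟩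
  length E                                                 ∎
  where
  open ≤-Reasoning
  in-E : ∀ i j → adj G i j ∧ (toℕ i <ᵇ toℕ j) ≡ true → (i , j) ∈ E
  in-E i j eq with adj G i j in a | toℕ i <ᵇ toℕ j in l
  ... | true | true = sub a (<ᵇ⇒< (toℕ i) (toℕ j) (subst T (≡.sym l) tt))

-- The maximum: symmetric, as a colouring must be, and equal to the second vertex on an edge from
-- `i` to `i + 1`.
_⊔ᶠ_ : ∀ {m} → Fin m → Fin m → Fin m
Fin.zero  ⊔ᶠ j         = j
Fin.suc i ⊔ᶠ Fin.zero  = Fin.suc i
Fin.suc i ⊔ᶠ Fin.suc j = Fin.suc (i ⊔ᶠ j)

⊔ᶠ-comm : ∀ {m} (i j : Fin m) → i ⊔ᶠ j ≡ j ⊔ᶠ i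
⊔ᶠ-comm Fin.zero    Fin.zero    = refl
⊔ᶠ-comm Fin.zero    (Fin.suc j) = refl
⊔ᶠ-comm (Fin.suc i) Fin.zero    = refl
⊔ᶠ-comm (Fin.suc i) (Fin.suc j) = cong Fin.suc (⊔ᶠ-comm i j)

inject₁-⊔ᶠ-suc : ∀ {m} (i : Fin m) → inject₁ i ⊔ᶠ Fin.suc i ≡ Fin.suc i
inject₁-⊔ᶠ-suc Fin.zero    = refl
inject₁-⊔ᶠ-suc (Fin.suc i) = cong Fin.suc (inject₁-⊔ᶠ-suc i)

≡ᵇ-refl : ∀ m → (m ≡ᵇ m) ≡ true
≡ᵇ-refl zero    = refl
≡ᵇ-refl (suc m) = ≡ᵇ-refl m

≡ᵇ-sound : ∀ m n → (m ≡ᵇ n) ≡ true → m ≡ n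
≡ᵇ-sound m n eq = ≡ᵇ⇒≡ m n (subst T (≡.sym eq) tt)

suc≢ᵇ : ∀ m → (suc m ≡ᵇ m) ≡ false
suc≢ᵇ zero    = refl
suc≢ᵇ (suc m) = suc≢ᵇ m

-- The cycle 0, 1, …, K together with e further vertices, each joined to the ends 0 and K of the chord. The edge
-- from i to i+1 has colour i+1 and the chord has colour 0; kind true stands for the colours (K , 1), false for (0 , 0).
module Hats (e k : ℕ) (kind : Fin e → Bool) (kind-injective : ∀ {z z′} → kind z ≡ kind z′ → z ≡ z′) where

  -- `K ≥ 2` keeps the chord apart from the edges of the path. The cycle has `K + 1` vertices and as
  -- many colours, so `e` hats give `N - e` colours.
  K N : ℕ
  K = suc (suc k)
  N = e + suc K

  step chord : Fin (suc K) → Fin (suc K) → Bool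
  step i j  = suc (toℕ i) ≡ᵇ toℕ j
  chord i j = (toℕ i ≡ᵇ 0) ∧ (toℕ j ≡ᵇ K)

  end : Fin (suc K) → Bool
  end i = (toℕ i ≡ᵇ 0) ∨ (toℕ i ≡ᵇ K)

  Vertex : Set
  Vertex = Fin e ⊎ Fin (suc K)

  adj′ : Vertex → Vertex → Bool
  adj′ (inj₁ _) (inj₁ _) = false
  adj′ (inj₁ _) (inj₂ i) = end i
  adj′ (inj₂ i) (inj₁ _) = end i
  adj′ (inj₂ i) (inj₂ j) = (step i j ∨ chord i j) ∨ (step j i ∨ chord j i)

  adj′-sym : ∀ s t → adj′ s t ≡ adj′ t s
  adj′-sym (inj₁ _) (inj₁ _) = refl
  adj′-sym (inj₁ _) (inj₂ _) = refl
  adj′-sym (inj₂ _) (inj₁ _) = refl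
  adj′-sym (inj₂ i) (inj₂ j) = Bool.∨-comm (step i j ∨ chord i j) _

  adj′-irrefl : ∀ s → adj′ s s ≡ false
  adj′-irrefl (inj₁ _) = refl
  adj′-irrefl (inj₂ Fin.zero) = refl
  adj′-irrefl (inj₂ (Fin.suc i)) rewrite suc≢ᵇ (toℕ i) = refl

  α β : Fin e → Fin (suc K)
  α z = if kind z then fromℕ K else 0F
  β z = if kind z then 1F else 0F

  col′ : Vertex → Vertex → Fin (suc K)
  col′ (inj₁ _) (inj₁ _) = 0F
  -- Only `0` and `K` are adjacent to a hat; at the vertices between them `β z` is a default value.
  col′ (inj₁ z) (inj₂ i) = if toℕ i ≡ᵇ 0 then α z else β z
  col′ (inj₂ i) (inj₁ z) = if toℕ i ≡ᵇ 0 then α z else β z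
  col′ (inj₂ i) (inj₂ j) = if chord i j ∨ chord j i then 0F else i ⊔ᶠ j

  col′-sym : ∀ s t → col′ s t ≡ col′ t s
  col′-sym (inj₁ _) (inj₁ _) = refl
  col′-sym (inj₁ _) (inj₂ _) = refl
  col′-sym (inj₂ _) (inj₁ _) = refl
  col′-sym (inj₂ i) (inj₂ j) = cong₂ (λ b m → if b then 0F else m) (Bool.∨-comm (chord i j) (chord j i)) (⊔ᶠ-comm i j)

  G : Graph N
  G = record
    { adj    = λ u v → adj′ (splitAt e u) (splitAt e v)
    ; sym    = λ u v → adj′-sym (splitAt e u) (splitAt e v)
    ; irrefl = λ u → adj′-irrefl (splitAt e u) }

  c : Colouring G (suc K)
  c = record
    { col    = λ u v → col′ (splitAt e u) (splitAt e v)
    ; colSym = λ u v → col′-sym (splitAt e u) (splitAt e v) }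

  ring : Fin (suc K) → Fin N
  ring = e ↑ʳ_

  hat : Fin e → Fin N
  hat = _↑ˡ suc K

  split-ring : ∀ i → splitAt e (ring i) ≡ inj₂ i
  split-ring = splitAt-↑ʳ e (suc K)

  split-hat : ∀ z → splitAt e (hat z) ≡ inj₁ z
  split-hat z = splitAt-↑ˡ e z (suc K)

  step-edge : ∀ i → Adj G (ring (inject₁ i)) (ring (Fin.suc i))
  step-edge i rewrite split-ring (inject₁ i) | split-ring (Fin.suc i) | toℕ-inject₁ i | ≡ᵇ-refl (toℕ i) = refl

  step-colour : ∀ i → col c (ring (inject₁ i)) (ring (Fin.suc i)) ≡ Fin.suc i
  step-colour i rewrite split-ring (inject₁ i) | split-ring (Fin.suc i) | inject₁-⊔ᶠ-suc i = no-chord i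
    where
    no-chord : ∀ i → (if chord (inject₁ i) (Fin.suc i) ∨ chord (Fin.suc i) (inject₁ i) then 0F else Fin.suc i) ≡ Fin.suc i
    no-chord Fin.zero    = refl
    no-chord (Fin.suc i) = refl

  a b : Fin N
  a = ring 0F
  b = ring (fromℕ K)
  L : List (Fin N)
  L = tabulate (ring ∘ Fin.suc)

  tabulate-walk : ∀ m (f : Fin (suc m) → Fin N) → (∀ i → Adj G (f (inject₁ i)) (f (Fin.suc i))) →
                  Walk G (f 0F) (tabulate (f ∘ Fin.suc)) (f (fromℕ m))
  tabulate-walk zero    f adjs = []
  tabulate-walk (suc m) f adjs = adjs 0F ∷ tabulate-walk m (f ∘ Fin.suc) (adjs ∘ Fin.suc)

  tabulate-cols : ∀ m (f : Fin (suc m) → Fin N) (g : Fin m → Fin (suc K)) →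
                  (∀ i → col c (f (inject₁ i)) (f (Fin.suc i)) ≡ g i) → cols c (f 0F) (tabulate (f ∘ Fin.suc)) ≡ tabulate g
  tabulate-cols zero    f g eqs = refl
  tabulate-cols (suc m) f g eqs = cong₂ _∷_ (eqs 0F) (tabulate-cols m (f ∘ Fin.suc) (g ∘ Fin.suc) (eqs ∘ Fin.suc))

  pL : Walk G a L b
  pL = tabulate-walk K ring step-edge

  uL : Unique (a ∷ L)
  uL = Unique.tabulate⁺ (↑ʳ-injective e _ _)

  cols-L : cols c a L ≡ tabulate Fin.suc
  cols-L = tabulate-cols K ring Fin.suc step-colour

  cL : Unique (cols c a L)
  cL = subst Unique (≡.sym cols-L) (Unique.tabulate⁺ Fin-suc-injective)

  ab : Adj G a b
  ab rewrite split-ring 0F | split-ring (fromℕ K) | toℕ-fromℕ k | ≡ᵇ-refl k = refl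

  χ≡0 : col c a b ≡ 0F
  χ≡0 rewrite split-ring 0F | split-ring (fromℕ K) | toℕ-fromℕ k | ≡ᵇ-refl k = refl

  0∉ : 0F ∉ cols c a L
  0∉ 0∈ with ∈-tabulate⁻ {f = Fin.suc} (subst (0F ∈_) cols-L 0∈)
  ... | _ , ()

  open HattedCycle c pL uL cL ab (subst (_∉ cols c a L) (≡.sym χ≡0) 0∉)

  -- Each edge of the path is coloured by its second vertex.
  Labelled : Fin N → List (Fin N) → Set
  Labelled u M = map ring (cols c u M) ≡ M

  labelled-L : Labelled a L
  labelled-L = ≡.trans (cong (map ring) cols-L) (map-tabulate Fin.suc ring)

  labelled-++ : ∀ {u M₁ v M₂} → Walk G u M₁ v → Labelled u (M₁ ++ M₂) → Labelled u M₁ × Labelled v M₂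
  labelled-++ []      eq = refl , eq
  labelled-++ (_ ∷ p) eq with labelled-++ p (∷-injectiveʳ eq)
  ... | eq₁ , eq₂ = cong₂ _∷_ (∷-injectiveˡ eq) eq₁ , eq₂

  module _ (z : Fin e) where

    adjᵃ : Adj G (hat z) a
    adjᵃ rewrite split-hat z | split-ring 0F = refl

    adjᵇ : Adj G (hat z) b
    adjᵇ rewrite split-hat z | split-ring (fromℕ K) | toℕ-fromℕ k | ≡ᵇ-refl k = refl

    colᵃ : col c (hat z) a ≡ α z
    colᵃ rewrite split-hat z | split-ring 0F = refl

    colᵇ : col c (hat z) b ≡ β z
    colᵇ rewrite split-hat z | split-ring (fromℕ K) = refl

    hat≢ring : ∀ i → hat z ≢ ring i
    hat≢ring i eq with ≡.trans (≡.sym (split-hat z)) (≡.trans (cong (splitAt e) eq) (split-ring i))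
    ... | ()

    -- The colours on `L₁` name its vertices. Colour `K` would thus put `b` on `L₁`, although
    -- `u ≢ b` places it on `L₂`; colour 0 does not occur on the path at all.
    α∉ : ∀ {L₁ L₂ u} → L ≡ L₁ ++ L₂ → Walk G a L₁ u → Walk G u L₂ b → u ≢ b → α z ∉ cols c a L₁
    α∉ {L₁} {L₂} eq p₁ p₂ u≢b α∈ with kind z
    ... | true = unique-++-disjoint L₁ (unique-tail (subst (λ S → Unique (a ∷ S)) eq uL))
                   (subst (b ∈_) (proj₁ (labelled-++ p₁ (subst (Labelled a) eq labelled-L))) (∈-map⁺ ring α∈))
                   (walk-end∈tail p₂ u≢b)
    ... | false = 0∉ (subst (λ S → 0F ∈ cols c a S) (≡.sym eq) (subst (0F ∈_) (≡.sym (cols-++ c L₂ p₁)) (∈-++⁺ˡ α∈)))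

    -- Colour 1 would put `ring 1F` on `L₂`, but as `u ≢ a` it is the first vertex of `L₁`.
    β∉ : ∀ {L₁ L₂ u} → L ≡ L₁ ++ L₂ → Walk G a L₁ u → Walk G u L₂ b → u ≢ a → β z ∉ cols c u L₂
    β∉ {[]} eq [] p₂ u≢a β∈ = u≢a refl
    β∉ {L₁@(_ ∷ _)} {L₂} eq p₁ p₂ u≢a β∈ with kind z
    ... | true = unique-++-disjoint L₁ (unique-tail (subst (λ S → Unique (a ∷ S)) eq uL))
                   (here (∷-injectiveˡ eq))
                   (subst (ring 1F ∈_) (proj₂ (labelled-++ p₁ (subst (Labelled a) eq labelled-L))) (∈-map⁺ ring β∈))
    ... | false = 0∉ (subst (λ S → 0F ∈ cols c a S) (≡.sym eq) (subst (0F ∈_) (≡.sym (cols-++ c L₂ p₁)) (∈-++⁺ʳ (cols c a L₁) β∈)))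

    αend : α z ∉ cols c a L ⊎ α z ≢ 0F
    αend with kind z
    ... | true  = inj₂ λ ()
    ... | false = inj₁ 0∉

    βend : β z ∉ cols c a L ⊎ β z ≢ 0F
    βend with kind z
    ... | true  = inj₂ λ ()
    ... | false = inj₁ 0∉

    is-hat : Hat (hat z)
    is-hat = record
      { z∉    = λ z∈ → case ∈-tabulate⁻ {f = ring} z∈ of λ { (i , eq) → hat≢ring i eq }
      ; za    = adjᵃ
      ; zb    = adjᵇ
      ; fromᵃ = λ eq p₁ p₂ u≢b → subst (_∉ _) (≡.sym colᵃ) (α∉ eq p₁ p₂ u≢b)
      ; fromᵇ = λ eq p₁ p₂ u≢a → subst (_∉ _) (≡.sym colᵇ) (β∉ eq p₁ p₂ u≢a)
      ; endᵃ  = subst₂ (λ s t → s ∉ cols c a L ⊎ s ≢ t) (≡.sym colᵃ) (≡.sym χ≡0) αend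
      ; endᵇ  = subst₂ (λ s t → s ∉ cols c a L ⊎ s ≢ t) (≡.sym colᵇ) (≡.sym χ≡0) βend
      }

  data View : Fin N → Set where
    hatᵛ  : ∀ z → View (hat z)
    ringᵛ : ∀ i → View (ring i)

  view : ∀ v → View v
  view v with splitAt e v | join-splitAt e (suc K) v
  ... | inj₁ z | refl = hatᵛ z
  ... | inj₂ i | refl = ringᵛ i

  ring∈ : ∀ i → ring i ∈ a ∷ L
  ring∈ = ∈-tabulate⁺ {f = ring}

  distinct-hats : ∀ {z z′} → Hat z → Hat z′ → z ≢ z′ → col c z a ≢ col c z′ a × col c z b ≢ col c z′ b
  distinct-hats {v} {v′} H H′ v≢v′ with view v | view v′
  ... | ringᵛ i | _        = ⊥-elim (Hat.z∉ H (ring∈ i))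
  ... | hatᵛ _  | ringᵛ i  = ⊥-elim (Hat.z∉ H′ (ring∈ i))
  ... | hatᵛ z  | hatᵛ z′  =
    (λ eq → kinds≢ (α-kind (≡.trans (≡.sym (colᵃ z)) (≡.trans eq (colᵃ z′))))) ,
    (λ eq → kinds≢ (β-kind (≡.trans (≡.sym (colᵇ z)) (≡.trans eq (colᵇ z′)))))
    where
    kinds≢ : kind z ≢ kind z′
    kinds≢ eq = v≢v′ (cong hat (kind-injective eq))
    α-kind : α z ≡ α z′ → kind z ≡ kind z′
    α-kind eq with kind z | kind z′
    α-kind _  | true  | true  = refl
    α-kind _  | false | false = refl
    β-kind : β z ≡ β z′ → kind z ≡ kind z′
    β-kind eq with kind z | kind z′
    β-kind _  | true  | true  = refl
    β-kind _  | false | false = refl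

  rainbow : Rainbow2Connected c
  rainbow = pairs⇒rainbow2 c (ring-pairs hat-or-ring distinct-hats)
    where
    hat-or-ring : ∀ v → v ∈ a ∷ L ⊎ Hat v
    hat-or-ring v with view v
    ... | hatᵛ z  = inj₂ (is-hat z)
    ... | ringᵛ i = inj₁ (ring∈ i)

  admissible : Admissible N (suc K) G
  admissible = rainbow2⇒2-connected c (≤-trans (s≤s (s≤s (s≤s z≤n))) (m≤n+m (suc K) e)) rainbow , c , rainbow

  path-edge : Fin K → Fin N × Fin N
  path-edge i = ring (inject₁ i) , ring (Fin.suc i)

  hat-edgeᵃ hat-edgeᵇ : Fin e → Fin N × Fin N
  hat-edgeᵃ z = hat z , a
  hat-edgeᵇ z = hat z , b

  edges : List (Fin N × Fin N)
  edges = (a , b) ∷ tabulate path-edge ++ tabulate hat-edgeᵃ ++ tabulate hat-edgeᵇ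

  length-edges : length edges ≡ N + e
  length-edges = begin
    length edges
      ≡⟨ cong suc (length-++ (tabulate path-edge)) ⟩
    suc (length (tabulate path-edge) + length (tabulate hat-edgeᵃ ++ tabulate hat-edgeᵇ))
      ≡⟨ cong₂ (λ s t → suc (s + t)) (length-tabulate path-edge)
           (≡.trans (length-++ (tabulate hat-edgeᵃ)) (cong₂ _+_ (length-tabulate hat-edgeᵃ) (length-tabulate hat-edgeᵇ))) ⟩
    suc (K + (e + e))
      ≡⟨ rearrange e K ⟩
    N + e ∎
    where
    open ≡-Reasoning
    rearrange : ∀ e K → suc (K + (e + e)) ≡ e + suc K + e
    rearrange = solve 2 (λ e K → con 1 :+ (K :+ (e :+ e)) := e :+ (con 1 :+ K) :+ e) refl
      where open +-*-Solver

  ∨-true : ∀ p {q} → p ∨ q ≡ true → p ≡ true ⊎ q ≡ true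
  ∨-true true  _  = inj₁ refl
  ∨-true false eq = inj₂ eq

  ∧-true : ∀ p {q} → p ∧ q ≡ true → p ≡ true × q ≡ true
  ∧-true true eq = refl , eq

  edges-complete : ∀ {u v} → Adj G u v → toℕ u < toℕ v → (u , v) ∈ edges
  edges-complete {u} {v} uv u<v with view u | view v
  ... | hatᵛ z | hatᵛ z′ rewrite split-hat z | split-hat z′ = case uv of λ ()
  ... | ringᵛ i | hatᵛ z = ⊥-elim (<-asym u<v (subst₂ _<_ (≡.sym (toℕ-↑ˡ z (suc K))) (≡.sym (toℕ-↑ʳ e i)) (<-≤-trans (toℕ<n z) (m≤m+n e (toℕ i)))))
  ... | hatᵛ z | ringᵛ i rewrite split-hat z | split-ring i with ∨-true (toℕ i ≡ᵇ 0) uv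
  ...   | inj₁ i0 with toℕ-injective {j = 0F} (≡ᵇ-sound (toℕ i) 0 i0)
  ...     | refl = there (∈-++⁺ʳ (tabulate path-edge) (∈-++⁺ˡ (∈-tabulate⁺ {f = hat-edgeᵃ} z)))
  edges-complete uv u<v | hatᵛ z | ringᵛ i | inj₂ iK with toℕ-injective {j = fromℕ K} (≡.trans (≡ᵇ-sound (toℕ i) K iK) (≡.sym (toℕ-fromℕ K)))
  ...     | refl = there (∈-++⁺ʳ (tabulate path-edge) (∈-++⁺ʳ (tabulate hat-edgeᵃ) (∈-tabulate⁺ {f = hat-edgeᵇ} z)))
  edges-complete uv u<v | ringᵛ i | ringᵛ j rewrite split-ring i | split-ring j = ring-edge i j (+-cancelˡ-< e _ _ (subst₂ _<_ (toℕ-↑ʳ e i) (toℕ-↑ʳ e j) u<v)) uv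
    where
    forward : ∀ i j → step i j ≡ true → (ring i , ring j) ∈ edges
    forward i (Fin.suc j) s with toℕ-injective {i = i} {j = inject₁ j} (≡.trans (≡ᵇ-sound (toℕ i) (toℕ j) s) (≡.sym (toℕ-inject₁ j)))
    ... | refl = there (∈-++⁺ˡ (∈-tabulate⁺ {f = path-edge} j))
    across : ∀ i j → chord i j ≡ true → i ≡ 0F × j ≡ fromℕ K
    across i j s with ∧-true (toℕ i ≡ᵇ 0) s
    ... | p , q = toℕ-injective (≡ᵇ-sound (toℕ i) 0 p) , toℕ-injective (≡.trans (≡ᵇ-sound (toℕ j) K q) (≡.sym (toℕ-fromℕ K)))
    ring-edge : ∀ i j → toℕ i < toℕ j → adj′ (inj₂ i) (inj₂ j) ≡ true → (ring i , ring j) ∈ edges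
    ring-edge i j i<j eq with ∨-true (step i j ∨ chord i j) eq
    ... | inj₁ le with ∨-true (step i j) le
    ...   | inj₁ s = forward i j s
    ...   | inj₂ s with across i j s
    ...     | refl , refl = here refl
    ring-edge i j i<j eq | inj₂ ge with ∨-true (step j i) ge
    ...   | inj₁ s = ⊥-elim (<-asym i<j (≤-reflexive (≡ᵇ-sound (suc (toℕ j)) (toℕ i) s)))
    ...   | inj₂ s with across j i s
    ...     | refl , _ = ⊥-elim (n≮0 i<j)

  edgeCount-G : edgeCount G ≤ N + e
  edgeCount-G = ≤-trans (edgeCount-≤ G edges edges-complete) (≤-reflexive length-edges)

T2≡-intro : ∀ {n r m} (G : Graph n) → Admissible n r G → edgeCount G ≤ m →
            (∀ (G : Graph n) → Admissible n r G → m ≤ edgeCount G) → T2≡ n r m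
T2≡-intro G ad le lower = (G , ad , ≤-antisym le (lower G ad)) , lower

theorem3p1 : ((n : ℕ) → 6 ≤ n → T2≡ n (n ∸ 2) (n + 2))
           × ((n : ℕ) → 4 ≤ n → T2≡ n (n ∸ 1) (n + 1))
theorem3p1 = two-hats , one-hat
  where
  two-hats : ∀ n → 6 ≤ n → T2≡ n (n ∸ 2) (n + 2)
  -- With `n = k + 5` and two hats the cycle has `k + 3` vertices, so `n - 2` colours; `suc r < n`
  -- then holds with equality in `≤-refl`.
  two-hats (suc (suc (suc (suc (suc k))))) 6≤n@(s≤s (s≤s (s≤s (s≤s (s≤s _))))) =
    T2≡-intro G admissible edgeCount-G λ { G′ (tc , c′ , rc) → fewer-colours⇒edges+2 G′ tc c′ rc 6≤n ≤-refl }
    where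
    kind : Fin 2 → Bool
    kind 0F = true
    kind 1F = false
    kind-injective : ∀ z z′ → kind z ≡ kind z′ → z ≡ z′
    kind-injective 0F 0F _  = refl
    kind-injective 1F 1F _  = refl
    kind-injective 0F 1F ()
    kind-injective 1F 0F ()
    open Hats 2 k kind (λ {z} {z′} → kind-injective z z′)
  one-hat : ∀ n → 4 ≤ n → T2≡ n (n ∸ 1) (n + 1)
  one-hat (suc (suc (suc (suc k)))) (s≤s (s≤s (s≤s (s≤s _)))) =
    T2≡-intro G admissible edgeCount-G λ { G′ (tc , c′ , rc) → few-colours⇒edges+1 G′ tc c′ rc ≤-refl }
    where
    single : (z z′ : Fin 1) → z ≡ z′
    single 0F 0F = refl
    open Hats 1 k (λ _ → true) (λ {z} {z′} _ → single z z′)
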